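{- Let $R$ be a ring with at least two non-trivial annihilating ideals. Then the following statements are equivalent: (1) $\omega(\mathcal{EG}(R))=2$. (2) $\chi(\mathcal{EG}(R))=2$. (3) $\mathcal{EG}(R)$ is bipartite. (4) $\mathcal{EG}(R)$ is complete bipartite. (5) $\mathcal{EG}(R)\in\{K_{1,1},K_{1,\infty},K_{\infty,\infty}\}$. (6) $R$ is one of the following rings: (i) $R=\mathbb{F}_1\times\mathbb{F}_2$, where $\mathbb{F}_1,\mathbb{F}_2$ are two fields. (ii) $R=\mathbb{F}\times D$, where $\mathbb{F}$ is a field and $D$ is an integral domain. (iii) $R$ is reduced, $|\mathrm{Min}(R)|=2$ and $\mathrm{Soc}(R)=0$. (iv) $R$ is a ring with exactly two non-trivial ideals $\mathrm{Nil}(R)$, $\mathrm{Nil}(R)^2$. (v) $R$ has a minimal ideal $I_1$ such that $I_1$ is not an essential ideal of $R$, $I_1^2=(0)$, and for any non-zero annihilating ideal $I_2$ of $R$, $\mathrm{Ann}(I_2)=I_1$.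
   Context: All rings are commutative with identity. $\mathrm{Ann}(I)$ denotes the annihilator of an ideal $I$ of $R$. $A(R)$ is the set of ideals of $R$ with non-zero annihilator (annihilating ideals), and $A(R)^*=A(R)\setminus\{(0)\}$; an ideal is non-trivial if it is non-zero and proper. A ring is reduced if $0$ is its only nilpotent element. $\mathrm{Min}(R)$ is the set of minimal prime ideals, $\mathrm{Nil}(R)$ the nilradical, and $\mathrm{Soc}(R)$ the sum of all minimal (simple) ideals of $R$ (zero if there are none). A non-zero ideal $I$ of $R$ is essential, written $I\leq_e R$, if it has non-zero intersection with every non-zero ideal of $R$. The essential annihilating-ideal graph $\mathcal{EG}(R)$ is the simple graph with vertex set $A(R)^*$ in which two distinct vertices $I,J$ are adjacent if and only if $\mathrm{Ann}(IJ)\leq_e R$. $\omega(G)$ and $\chi(G)$ denote the clique number and vertex chromatic number of a graph $G$. $K_{m,n}$ is the complete bipartite graph with parts of sizes $m$ and $n$, where the symbol $\infty$ means that the corresponding part is infinite.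
   Formalization: In (6)(v) the condition Ann(I_2)=I_1 is required only for non-zero annihilating ideals I_2 different from I_1; with I_2=I_1 allowed no ring satisfies (v), and the theorem fails for the idealization of Z/2 over Z. -}

module Defs where

open import Level using (Level; Setω; _⊔_; suc)
open import Data.Nat.Base using (ℕ; _≤_)
open import Data.Fin.Base using (Fin)
open import Data.Product.Base using (Σ; ∃; ∃₂; ∃-syntax; _×_; _,_; proj₁; proj₂)
open import Data.Sum.Base using (_⊎_)
open import Relation.Nullary.Negation.Core using (¬_)
open import Relation.Unary using (Pred; _∈_; _⊆_; _≐_; _∩_; Satisfiable; Universal)
open import Relation.Unary.Properties using (≐-refl; ≐-sym; ≐-trans)
open import Relation.Binary.Core using (Rel; _Preserves_⟶_)
open import Relation.Binary.Definitions using (_Respects_; _Respects₂_; Symmetric)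
open import Relation.Binary.Bundles using (Setoid; Poset)
open import Relation.Binary.PropositionalEquality.Core using (_≡_; _≢_)
open import Axiom.ExcludedMiddle using (ExcludedMiddle)
open import Algebra.Bundles using (CommutativeRing)
open import Algebra.Construct.DirectProduct using (commutativeRing)
open import Algebra.Morphism.Structures using (module RingMorphisms)
import Algebra.Properties.Semiring.Exp as Exp

-- The ambient logic of commutative algebra is classical set theory with choice;
-- Agda's is not, so the two principles below are carried as hypotheses.

LEM : Setω
LEM = ∀ {a} → ExcludedMiddle a

-- The empty predicate is a chain, so the premise forces P to be inhabited.
Zorn : Setω
Zorn = ∀ {a ℓ₁ ℓ₂ p} (P : Poset a ℓ₁ ℓ₂) → let open Poset P renaming (_≤_ to _≼_) in
  (∀ (C : Pred Carrier p) →
     (∀ {x y} → x ∈ C → y ∈ C → x ≼ y ⊎ y ≼ x) →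
     ∃[ u ] (∀ {x} → x ∈ C → x ≼ u)) →
  ∃[ m ] (∀ {x} → m ≼ x → x ≼ m)

record SimpleGraph (a b e : Level) : Set (suc (a ⊔ b ⊔ e)) where
  field
    vertices : Setoid a b
  open Setoid vertices public using (_≈_) renaming (Carrier to Vertex)
  field
    _~_    : Rel Vertex e
    ~-sym  : Symmetric _~_
    ~-irr  : ∀ {u v} → u ~ v → ¬ (u ≈ v)
    ~-resp : _~_ Respects₂ _≈_

data Size : Set where
  fin : ℕ → Size
  ∞   : Size

module _ {a b e} (G : SimpleGraph a b e) where
  open SimpleGraph G

  -- Adjacent vertices are distinct, so these are k distinct vertices.
  Clique : ℕ → Set (a ⊔ e)
  Clique k = Σ (Fin k → Vertex) λ v → ∀ {i j} → i ≢ j → v i ~ v j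

  CliqueNumber : ℕ → Set (a ⊔ e)
  CliqueNumber n = Clique n × (∀ {k} → Clique k → k ≤ n)

  Colouring : ℕ → Set (a ⊔ b ⊔ e)
  Colouring k = Σ (Vertex → Fin k) λ f →
    (f Preserves _≈_ ⟶ _≡_) × (∀ {u v} → u ~ v → f u ≢ f v)

  ChromaticNumber : ℕ → Set (a ⊔ b ⊔ e)
  ChromaticNumber n = Colouring n × (∀ {k} → Colouring k → n ≤ k)

  record IsBipartition (X Y : Pred Vertex e) : Set (a ⊔ b ⊔ e) where
    field
      X-resp   : X Respects _≈_
      Y-resp   : Y Respects _≈_
      cover    : ∀ v → v ∈ X ⊎ v ∈ Y
      disjoint : ∀ {v} → v ∈ X → ¬ (v ∈ Y)
      X-indep  : ∀ {u v} → u ∈ X → v ∈ X → ¬ (u ~ v)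
      Y-indep  : ∀ {u v} → u ∈ Y → v ∈ Y → ¬ (u ~ v)

  Bipartite : Set (a ⊔ b ⊔ suc e)
  Bipartite = ∃₂ IsBipartition

  record IsCompleteBipartition (X Y : Pred Vertex e) : Set (a ⊔ b ⊔ e) where
    field
      isBipartition : IsBipartition X Y
      X-nonempty    : Satisfiable X
      Y-nonempty    : Satisfiable Y
      complete      : ∀ {u v} → u ∈ X → v ∈ Y → u ~ v

  CompleteBipartite : Set (a ⊔ b ⊔ suc e)
  CompleteBipartite = ∃₂ IsCompleteBipartition

  HasSize : Pred Vertex e → ℕ → Set (a ⊔ b ⊔ e)
  HasSize X n = Σ (Fin n → Vertex) λ v →
    (∀ i → v i ∈ X) × (∀ {i j} → v i ≈ v j → i ≡ j) × (∀ {u} → u ∈ X → ∃[ i ] u ≈ v i)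

  PartSize : Pred Vertex e → Size → Set (a ⊔ b ⊔ e)
  PartSize X (fin n) = HasSize X n
  PartSize X ∞       = ∀ n → ¬ HasSize X n

  IsK : Size → Size → Set (a ⊔ b ⊔ suc e)
  IsK m n = ∃₂ λ X Y → IsCompleteBipartition X Y × PartSize X m × PartSize Y n

IsField : ∀ {c ℓ} → CommutativeRing c ℓ → Set (c ⊔ ℓ)
IsField R = ¬ (1# ≈ 0#) × (∀ x → ¬ (x ≈ 0#) → ∃[ y ] x * y ≈ 1#)
  where open CommutativeRing R

IsDomain : ∀ {c ℓ} → CommutativeRing c ℓ → Set (c ⊔ ℓ)
IsDomain R = ¬ (1# ≈ 0#) × (∀ x y → x * y ≈ 0# → x ≈ 0# ⊎ y ≈ 0#)
  where open CommutativeRing R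

_≅_ : ∀ {c₁ ℓ₁ c₂ ℓ₂} → CommutativeRing c₁ ℓ₁ → CommutativeRing c₂ ℓ₂ → Set (c₁ ⊔ ℓ₁ ⊔ c₂ ⊔ ℓ₂)
R ≅ S = ∃ (RingMorphisms.IsRingIsomorphism (rawRing R) (rawRing S))
  where open CommutativeRing using (rawRing)

module _ {c ℓ} (R : CommutativeRing c ℓ) where
  open CommutativeRing R
  open Exp semiring using (_^_)

  record IsIdeal {p} (I : Pred Carrier p) : Set (c ⊔ ℓ ⊔ p) where
    field
      resp     : I Respects _≈_
      0-mem    : 0# ∈ I
      +-closed : ∀ {x y} → x ∈ I → y ∈ I → x + y ∈ I
      *-closed : ∀ r {x} → x ∈ I → r * x ∈ I

  -- Membership lives in the least level closed under principal ideals,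
  -- annihilators and products; by excluded middle every ideal of a higher level
  -- has the same elements as one of these.
  record Ideal : Set (suc (c ⊔ ℓ)) where
    constructor ideal
    field
      mem     : Pred Carrier (c ⊔ ℓ)
      isIdeal : IsIdeal mem
  open Ideal

  -- The ideal generated by S.
  data ⟨_⟩ {p} (S : Pred Carrier p) : Pred Carrier (c ⊔ ℓ ⊔ p) where
    gen  : ∀ {x} → x ∈ S → x ∈ ⟨ S ⟩
    zer  : 0# ∈ ⟨ S ⟩
    add  : ∀ {x y} → x ∈ ⟨ S ⟩ → y ∈ ⟨ S ⟩ → x + y ∈ ⟨ S ⟩
    mul  : ∀ r {x} → x ∈ ⟨ S ⟩ → r * x ∈ ⟨ S ⟩
    resp : ∀ {x y} → x ≈ y → x ∈ ⟨ S ⟩ → y ∈ ⟨ S ⟩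

  infixl 7 _·_
  _·_ : ∀ {p q} → Pred Carrier p → Pred Carrier q → Pred Carrier (c ⊔ ℓ ⊔ p ⊔ q)
  I · J = ⟨ (λ x → ∃₂ λ a b → a ∈ I × b ∈ J × x ≈ a * b) ⟩

  Ann : ∀ {p} → Pred Carrier p → Pred Carrier (c ⊔ ℓ ⊔ p)
  Ann I x = ∀ {y} → y ∈ I → x * y ≈ 0#

  IsZero : ∀ {p} → Pred Carrier p → Set (c ⊔ ℓ ⊔ p)
  IsZero I = ∀ {x} → x ∈ I → x ≈ 0#

  NonZero : ∀ {p} → Pred Carrier p → Set (c ⊔ ℓ ⊔ p)
  NonZero I = ∃[ x ] x ∈ I × ¬ (x ≈ 0#)

  Proper : ∀ {p} → Pred Carrier p → Set (c ⊔ p)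
  Proper I = ¬ Universal I

  NonTrivial : ∀ {p} → Pred Carrier p → Set (c ⊔ ℓ ⊔ p)
  NonTrivial I = NonZero I × Proper I

  Annihilating : ∀ {p} → Pred Carrier p → Set (c ⊔ ℓ ⊔ p)
  Annihilating I = NonZero (Ann I)

  Essential : ∀ {p} → Pred Carrier p → Set (suc (c ⊔ ℓ) ⊔ p)
  Essential I = NonZero I × (∀ (J : Ideal) → NonZero (mem J) → NonZero (I ∩ mem J))

  Minimal : Ideal → Set (suc (c ⊔ ℓ))
  Minimal I = NonZero (mem I) ×
    (∀ (J : Ideal) → NonZero (mem J) → mem J ⊆ mem I → mem I ⊆ mem J)

  Prime : Ideal → Set (c ⊔ ℓ)
  Prime P = Proper (mem P) × (∀ {x y} → x * y ∈ mem P → x ∈ mem P ⊎ y ∈ mem P)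

  MinimalPrime : Ideal → Set (suc (c ⊔ ℓ))
  MinimalPrime P = Prime P × (∀ (Q : Ideal) → Prime Q → mem Q ⊆ mem P → mem P ⊆ mem Q)

  Nil : Pred Carrier ℓ
  Nil x = ∃[ n ] x ^ n ≈ 0#

  Soc : Pred Carrier (suc (c ⊔ ℓ))
  Soc = ⟨ (λ x → ∃[ I ] Minimal I × x ∈ mem I) ⟩

  Reduced : Set (c ⊔ ℓ)
  Reduced = IsZero Nil

  AtLeastTwoNonTrivialAnnihilating : Set (suc (c ⊔ ℓ))
  AtLeastTwoNonTrivialAnnihilating = ∃₂ λ (I J : Ideal) →
    (NonTrivial (mem I) × Annihilating (mem I)) ×
    (NonTrivial (mem J) × Annihilating (mem J)) ×
    ¬ (mem I ≐ mem J)

  |Min|≡2 : Set (suc (c ⊔ ℓ))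
  |Min|≡2 = ∃₂ λ (P Q : Ideal) → MinimalPrime P × MinimalPrime Q × ¬ (mem P ≐ mem Q) ×
    (∀ (S : Ideal) → MinimalPrime S → mem S ≐ mem P ⊎ mem S ≐ mem Q)

  ·-mono : ∀ {p q p′ q′} {I : Pred Carrier p} {J : Pred Carrier q}
           {I′ : Pred Carrier p′} {J′ : Pred Carrier q′} →
           I ⊆ I′ → J ⊆ J′ → I · J ⊆ I′ · J′
  ·-mono f g (gen (a , b , a∈I , b∈J , eq)) = gen (a , b , f a∈I , g b∈J , eq)
  ·-mono f g zer          = zer
  ·-mono f g (add s t)    = add (·-mono f g s) (·-mono f g t)
  ·-mono f g (mul r s)    = mul r (·-mono f g s)
  ·-mono f g (resp eq s)  = resp eq (·-mono f g s)

  ·-comm : ∀ {p q} {I : Pred Carrier p} {J : Pred Carrier q} → I · J ⊆ J · I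
  ·-comm (gen (a , b , a∈I , b∈J , eq)) = gen (b , a , b∈J , a∈I , trans eq (*-comm a b))
  ·-comm zer          = zer
  ·-comm (add s t)    = add (·-comm s) (·-comm t)
  ·-comm (mul r s)    = mul r (·-comm s)
  ·-comm (resp eq s)  = resp eq (·-comm s)

  Ann-mono : ∀ {p q} {I : Pred Carrier p} {J : Pred Carrier q} →
             J ⊆ I → Essential (Ann I) → Essential (Ann J)
  Ann-mono f ((x , x∈ , x≉0) , ess) = (x , (λ y∈J → x∈ (f y∈J)) , x≉0) , λ K K≠0 →
    let (y , (y∈ , y∈K) , y≉0) = ess K K≠0 in y , ((λ z∈J → y∈ (f z∈J)) , y∈K) , y≉0

  EG : SimpleGraph (suc (c ⊔ ℓ)) (c ⊔ ℓ) (suc (c ⊔ ℓ))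
  EG = record
    { vertices = record
        { Carrier       = Σ Ideal λ I → Annihilating (mem I) × NonZero (mem I)
        ; _≈_           = λ u v → set u ≐ set v
        ; isEquivalence = record { refl = ≐-refl ; sym = ≐-sym ; trans = ≐-trans }
        }
    ; _~_    = λ u v → ¬ (set u ≐ set v) × Essential (Ann (set u · set v))
    ; ~-sym  = λ (u≠v , ess) → (λ e → u≠v (≐-sym e)) , Ann-mono ·-comm ess
    ; ~-irr  = proj₁
    ; ~-resp = (λ e (u≠v , ess) → (λ e′ → u≠v (≐-trans e′ (≐-sym e))) ,
                  Ann-mono (·-mono (λ z → z) (proj₂ e)) ess)
             , (λ e (u≠v , ess) → (λ e′ → u≠v (≐-trans e e′)) ,
                  Ann-mono (·-mono (proj₂ e) (λ z → z)) ess)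
    }
    where
    set : (Σ Ideal λ I → Annihilating (mem I) × NonZero (mem I)) → Pred Carrier (c ⊔ ℓ)
    set (I , _) = mem I

  ProductOfTwoFields : Set (suc (c ⊔ ℓ))
  ProductOfTwoFields = ∃₂ λ (F₁ F₂ : CommutativeRing c ℓ) →
    IsField F₁ × IsField F₂ × R ≅ commutativeRing F₁ F₂

  ProductOfFieldAndDomain : Set (suc (c ⊔ ℓ))
  ProductOfFieldAndDomain = ∃₂ λ (F D : CommutativeRing c ℓ) →
    IsField F × IsDomain D × R ≅ commutativeRing F D

  ReducedTwoMinimalPrimesZeroSocle : Set (suc (c ⊔ ℓ))
  ReducedTwoMinimalPrimesZeroSocle = Reduced × |Min|≡2 × IsZero Soc

  ExactlyNilAndNilSquared : Set (suc (c ⊔ ℓ))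
  ExactlyNilAndNilSquared =
    NonTrivial Nil × NonTrivial (Nil · Nil) × ¬ (Nil ≐ Nil · Nil) ×
    (∀ (I : Ideal) → NonTrivial (mem I) → mem I ≐ Nil ⊎ mem I ≐ Nil · Nil)

  -- I₂ ranges over the annihilating ideals other than I₁.  Were I₂ = I₁ allowed,
  -- I₁ would be its own annihilator, hence a maximal as well as minimal ideal of
  -- square zero, hence the only non-trivial ideal of R, hence essential: no ring
  -- would qualify.
  NonEssentialMinimalSquareZero : Set (suc (c ⊔ ℓ))
  NonEssentialMinimalSquareZero = ∃[ I₁ ]
    Minimal I₁ × ¬ Essential (mem I₁) × IsZero (mem I₁ · mem I₁) ×
    (∀ (I₂ : Ideal) → NonZero (mem I₂) → Annihilating (mem I₂) → ¬ (mem I₂ ≐ mem I₁) →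
       Ann (mem I₂) ≐ mem I₁)

  Classification : Set (suc (c ⊔ ℓ))
  Classification =
    ProductOfTwoFields ⊎ ProductOfFieldAndDomain ⊎ ReducedTwoMinimalPrimesZeroSocle ⊎
    ExactlyNilAndNilSquared ⊎ NonEssentialMinimalSquareZero

{-# OPTIONS --safe #-}
-- Each of the graph conditions forces EG(R) to be triangle-free, so it suffices to
-- describe the rings R for which it is.
--
-- If R is reduced, Ann(IJ) is essential only when IJ = 0.  For a vertex I, triangle-freeness
-- makes P = Ann I and Q = Ann P prime, and P ∩ Q = 0; the vertices are then the non-zero ideals
-- inside P and those inside Q.  If P contains only finitely many ideals, two powers
-- of any non-zero a ∈ P generate the same ideal, which makes a invertible modulo Q and P a
-- simple ideal: hence a part has size 1 or ∞.  A minimal ideal of R is generated by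
-- an idempotent, which splits R as a field times a domain.
--
-- If R is not reduced, it has y ≠ 0 with y² = 0, and ⟪ y ⟫ is adjacent to every other vertex.  A
-- second such dominating vertex leaves no room for a third vertex, and R has just the two
-- non-trivial ideals Nil and Nil²; otherwise EG(R) is a star centred at ⟪ y ⟫, the annihilator
-- of all its leaves.
module Submission where

open import Defs
open import Level using (Level; Lift; lift; lower; _⊔_)
open import Data.Empty using (⊥; ⊥-elim)
open import Data.Fin.Base using (Fin; zero; suc; toℕ)
open import Data.Fin.Properties using (pigeonhole; <⇒≢)
open import Data.Nat.Base as ℕ using (ℕ; zero; suc; _≤_; z≤n; s≤s)
open import Data.Nat.Properties as ℕ using (≮⇒≥)
open import Data.Product.Base using (Σ; ∃; ∃₂; _×_; _,_; proj₁; proj₂)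
open import Data.Sum.Base as Sum using (_⊎_; inj₁; inj₂; [_,_]; swap; fromInj₁; fromInj₂)
open import Function.Base using (_∘_; id)
open import Function.Bundles using (_⇔_; mk⇔)
open import Algebra.Bundles using (CommutativeRing)
open import Algebra.Construct.DirectProduct using (commutativeRing)
open import Algebra.Morphism.Structures using (module RingMorphisms)
open import Relation.Nullary using (yes; no; ¬_)
open import Relation.Nullary.Decidable using (True; toWitness; fromWitness; decidable-stable)
open import Relation.Unary using (Pred; _∈_; _⊆_; _≐_; _∩_)
open import Relation.Unary.Properties using (≐-refl; ≐-sym; ≐-trans)
open import Relation.Binary.Core using (_Preserves_⟶_)
open import Relation.Binary.Bundles using (Poset)
open import Relation.Binary.PropositionalEquality.Core as ≡ using (_≡_; _≢_)
import Algebra.Properties.AbelianGroup as AbelianGroupProperties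
import Algebra.Properties.CommutativeSemigroup as CommutativeSemigroupProperties
import Algebra.Properties.CommutativeSemiring.Exp as Exp
import Algebra.Properties.Ring as RingProperties
import Relation.Binary.Reasoning.Setoid as SetoidReasoning

-- Cliques, colourings and bipartitions of simple graphs.

module _ {a b e} (G : SimpleGraph a b e) where
  open SimpleGraph G

  TriangleFree : Set (a ⊔ e)
  TriangleFree = ∀ u v w → u ~ v → v ~ w → ¬ (u ~ w)

  Edge : Set (a ⊔ e)
  Edge = ∃₂ λ u v → u ~ v

  triangleFree⇒noLargeClique : TriangleFree → ∀ {k} → Clique G k → k ≤ 2
  triangleFree⇒noLargeClique tf {0} _ = z≤n
  triangleFree⇒noLargeClique tf {1} _ = s≤s z≤n
  triangleFree⇒noLargeClique tf {2} _ = s≤s (s≤s z≤n)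
  triangleFree⇒noLargeClique tf {suc (suc (suc _))} (v , adj) =
    ⊥-elim (tf _ _ _ (adj {zero} {suc zero} λ ()) (adj {suc zero} {suc (suc zero)} λ ()) (adj λ ()))

  noLargeClique⇒triangleFree : (∀ {k} → Clique G k → k ≤ 2) → TriangleFree
  noLargeClique⇒triangleFree small u v w u~v v~w u~w
    with small {3} (corner , λ {i} {j} → adj i j)
    where
    corner : Fin 3 → Vertex
    corner zero             = u
    corner (suc zero)       = v
    corner (suc (suc zero)) = w
    adj : ∀ i j → i ≢ j → corner i ~ corner j
    adj zero             zero             i≢j = ⊥-elim (i≢j ≡.refl)
    adj zero             (suc zero)       _   = u~v
    adj zero             (suc (suc zero)) _   = u~w
    adj (suc zero)       zero             _   = ~-sym u~v
    adj (suc zero)       (suc zero)       i≢j = ⊥-elim (i≢j ≡.refl)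
    adj (suc zero)       (suc (suc zero)) _   = v~w
    adj (suc (suc zero)) zero             _   = ~-sym u~w
    adj (suc (suc zero)) (suc zero)       _   = ~-sym v~w
    adj (suc (suc zero)) (suc (suc zero)) i≢j = ⊥-elim (i≢j ≡.refl)
  ... | s≤s (s≤s ())

  edge∧triangleFree⇒ω≡2 : Edge → TriangleFree → CliqueNumber G 2
  edge∧triangleFree⇒ω≡2 (u , v , u~v) tf = (end , λ {i} {j} → adj i j) , triangleFree⇒noLargeClique tf
    where
    end : Fin 2 → Vertex
    end zero       = u
    end (suc zero) = v
    adj : ∀ i j → i ≢ j → end i ~ end j
    adj zero       zero       i≢j = ⊥-elim (i≢j ≡.refl)
    adj zero       (suc zero) _   = u~v
    adj (suc zero) zero       _   = ~-sym u~v
    adj (suc zero) (suc zero) i≢j = ⊥-elim (i≢j ≡.refl)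

  -- With more clique vertices than colours, the pigeonhole principle gives two of the same colour,
  -- yet they are adjacent.
  colouring⇒noLargeClique : ∀ {n} → Colouring G n → ∀ {k} → Clique G k → k ≤ n
  colouring⇒noLargeClique (f , _ , proper) (v , adj) = ≮⇒≥ λ n<k →
    let i , j , i<j , same = pigeonhole n<k (λ i → f (v i))
    in proper (adj (<⇒≢ i<j)) same

  bipartite⇒2-colouring : Bipartite G → Colouring G 2
  bipartite⇒2-colouring (X , Y , B) = colour , colour-cong , proper
    where
    open IsBipartition B
    pick : ∀ {v} → v ∈ X ⊎ v ∈ Y → Fin 2
    pick (inj₁ _) = zero
    pick (inj₂ _) = suc zero
    colour : Vertex → Fin 2
    colour v = pick (cover v)
    -- `cover` need not treat equal vertices alike; the mixed cases are excluded because the parts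
    -- respect equality and are disjoint.
    colour-cong : colour Preserves _≈_ ⟶ _≡_
    colour-cong {u} {v} u≈v with cover u | cover v
    ... | inj₁ _   | inj₁ _   = ≡.refl
    ... | inj₁ u∈X | inj₂ v∈Y = ⊥-elim (disjoint (X-resp u≈v u∈X) v∈Y)
    ... | inj₂ u∈Y | inj₁ v∈X = ⊥-elim (disjoint v∈X (Y-resp u≈v u∈Y))
    ... | inj₂ _   | inj₂ _   = ≡.refl
    proper : ∀ {u v} → u ~ v → colour u ≢ colour v
    proper {u} {v} u~v with cover u | cover v
    ... | inj₁ u∈X | inj₁ v∈X = λ _ → X-indep u∈X v∈X u~v
    ... | inj₁ _   | inj₂ _   = λ ()
    ... | inj₂ _   | inj₁ _   = λ ()
    ... | inj₂ u∈Y | inj₂ v∈Y = λ _ → Y-indep u∈Y v∈Y u~v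

  edge⇒2≤colours : Edge → ∀ {k} → Colouring G k → 2 ≤ k
  edge⇒2≤colours (u , v , u~v) {zero} (f , _) with f u
  ... | ()
  edge⇒2≤colours (u , v , u~v) {suc zero} (f , _ , proper) with f u | f v | proper u~v
  ... | zero | zero | fu≢fv = ⊥-elim (fu≢fv ≡.refl)
  edge⇒2≤colours _ {suc (suc _)} _ = s≤s (s≤s z≤n)

  edge∧bipartite⇒χ≡2 : Edge → Bipartite G → ChromaticNumber G 2
  edge∧bipartite⇒χ≡2 edge bip = bipartite⇒2-colouring bip , edge⇒2≤colours edge

  bipartite⇒triangleFree : Bipartite G → TriangleFree
  bipartite⇒triangleFree bip =
    noLargeClique⇒triangleFree (colouring⇒noLargeClique (bipartite⇒2-colouring bip))

  completeBipartite⇒bipartite : CompleteBipartite G → Bipartite G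
  completeBipartite⇒bipartite (X , Y , CB) = X , Y , IsCompleteBipartition.isBipartition CB

  IsK⇒completeBipartite : ∀ {m n} → IsK G m n → CompleteBipartite G
  IsK⇒completeBipartite (X , Y , CB , _) = X , Y , CB

  IsK-sym : ∀ {m n} → IsK G m n → IsK G n m
  IsK-sym (X , Y , CB , |X| , |Y|) = Y , X , record
    { isBipartition = record
        { X-resp   = Y-resp
        ; Y-resp   = X-resp
        ; cover    = λ v → swap (cover v)
        ; disjoint = λ v∈Y v∈X → disjoint v∈X v∈Y
        ; X-indep  = Y-indep
        ; Y-indep  = X-indep
        }
    ; X-nonempty = Y-nonempty
    ; Y-nonempty = X-nonempty
    ; complete   = λ u∈Y v∈X → ~-sym (complete v∈X u∈Y)
    } , |Y| , |X|
    where
    open IsCompleteBipartition CB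
    open IsBipartition isBipartition

  hasSize-1 : ∀ {X : Pred Vertex e} {v} → v ∈ X → (∀ {u} → u ∈ X → u ≈ v) → HasSize G X 1
  hasSize-1 {v = v} v∈X unique =
    (λ _ → v) , (λ _ → v∈X) , (λ { {zero} {zero} _ → ≡.refl }) , λ u∈X → zero , unique u∈X

-- Arithmetic of elements and ideals.

module EssentialGraph (lem : LEM) {c ℓ} (R : CommutativeRing c ℓ) where
  open CommutativeRing R hiding (zero)
  open Exp commutativeSemiring
  open AbelianGroupProperties +-abelianGroup using (xyx⁻¹≈y)
  open CommutativeSemigroupProperties *-commutativeSemigroup
  open RingProperties ring using ([y-z]x≈yx-zx; -‿distribʳ-*)
  open SetoidReasoning setoid
  open Ideal using (mem; isIdeal)
  open SimpleGraph (EG R) using (~-sym) renaming (Vertex to V; _~_ to infix 4 _~_)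

  module On (I : Ideal R) = IsIdeal (isIdeal I)

  set : V → Pred Carrier (c ⊔ ℓ)
  set (I , _) = mem I

  infix 4 _≣_
  _≣_ : V → V → Set (c ⊔ ℓ)
  u ≣ v = set u ≐ set v

  byContradiction : ∀ {a} {P : Set a} → ¬ ¬ P → P
  byContradiction = decidable-stable lem

  *-zeroʳ : ∀ x {y} → y ≈ 0# → x * y ≈ 0#
  *-zeroʳ x y≈0 = trans (*-congˡ y≈0) (zeroʳ x)

  *-zeroˡ : ∀ {x} y → x ≈ 0# → x * y ≈ 0#
  *-zeroˡ y x≈0 = trans (*-congʳ x≈0) (zeroˡ y)

  -- The only place where subtraction is used: z is 1 - x.
  complement : ∀ {x y} → y ≈ x * y → ∃ λ z → 1# ≈ x + z × z * y ≈ 0#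
  complement {x} {y} y≈xy = 1# - x , 1≈x+z , zy≈0
    where
    1≈x+z : 1# ≈ x + (1# - x)
    1≈x+z = sym (trans (sym (+-assoc x 1# (- x))) (xyx⁻¹≈y x 1#))
    zy≈0 : (1# - x) * y ≈ 0#
    zy≈0 = begin
      (1# - x) * y      ≈⟨ [y-z]x≈yx-zx y 1# x ⟩
      1# * y - x * y    ≈⟨ +-cong (*-identityˡ y) (-‿cong (sym y≈xy)) ⟩
      y - y             ≈⟨ -‿inverseʳ y ⟩
      0#                ∎

  decompose : ∀ {u m} → 1# ≈ u + m → ∀ x → x ≈ u * x + m * x
  decompose {u} {m} 1≈u+m x =
    trans (sym (*-identityˡ x)) (trans (*-congʳ 1≈u+m) (distribʳ x u m))

  -- On whatever `m` kills, `u` acts as the identity; decompositions of 1 are mostly used in this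
  -- form.
  decompose-killed : ∀ {u m x} → 1# ≈ u + m → m * x ≈ 0# → x ≈ u * x
  decompose-killed {x = x} 1≈u+m mx≈0 =
    trans (decompose 1≈u+m x) (trans (+-congˡ mx≈0) (+-identityʳ _))

  -- Descend to the last non-zero power of `x`: its square is a multiple of the next power, which
  -- vanishes.
  square-zero : ∀ {x} → ¬ (x ≈ 0#) → ∀ n → x ^ n ≈ 0# → ∃ λ y → ¬ (y ≈ 0#) × y * y ≈ 0#
  square-zero {x} x≉0 0 1≈0 = ⊥-elim (x≉0 (trans (sym (*-identityʳ x)) (*-zeroʳ x 1≈0)))
  square-zero {x} x≉0 1 x≈0 = ⊥-elim (x≉0 (trans (sym (*-identityʳ x)) x≈0))
  square-zero {x} x≉0 (suc (suc n)) x^≈0 with lem {P = x ^ suc n ≈ 0#} | square-zero x≉0 (suc n)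
  ... | yes x^≈0′ | smaller = smaller x^≈0′
  ... | no  x^≉0  | _       = x ^ suc n , x^≉0 , trans (xy∙z≈y∙xz x (x ^ n) (x ^ suc n)) (*-zeroʳ (x ^ n) x^≈0)

  *-closedʳ : ∀ (I : Ideal R) r {x} → x ∈ mem I → x * r ∈ mem I
  *-closedʳ I r {x} x∈I = On.resp I (*-comm r x) (On.*-closed I r x∈I)

  1∈⇒universal : ∀ (I : Ideal R) → 1# ∈ mem I → ∀ x → x ∈ mem I
  1∈⇒universal I 1∈I x = On.resp I (*-identityʳ x) (On.*-closed I x 1∈I)

  1∉proper : ∀ (I : Ideal R) → Proper R (mem I) → ¬ (1# ∈ mem I)
  1∉proper I proper 1∈I = proper (1∈⇒universal I 1∈I)

  ¬IsZero⇒NonZero : ∀ {p} {I : Pred Carrier p} → ¬ IsZero R I → NonZero R I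
  ¬IsZero⇒NonZero I≠0 = byContradiction λ none →
    I≠0 λ {x} x∈I → byContradiction λ x≉0 → none (x , x∈I , x≉0)

  ⊈⇒∃ : ∀ {p q} {I : Pred Carrier p} {J : Pred Carrier q} → ¬ (I ⊆ J) → ∃ λ x → x ∈ I × ¬ (x ∈ J)
  ⊈⇒∃ I⊈J = byContradiction λ none →
    I⊈J λ {x} x∈I → byContradiction λ x∉J → none (x , x∈I , x∉J)

  ⟪_⟫ : Carrier → Ideal R
  ⟪ a ⟫ = ideal (λ x → ∃ λ r → x ≈ r * a) record
    { resp     = λ x≈y (r , x≈ra) → r , trans (sym x≈y) x≈ra
    ; 0-mem    = 0# , sym (zeroˡ a)
    ; +-closed = λ (r , x≈ra) (s , y≈sa) → r + s , trans (+-cong x≈ra y≈sa) (sym (distribʳ a r s))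
    ; *-closed = λ t (r , x≈ra) → t * r , trans (*-congˡ x≈ra) (sym (*-assoc t r a))
    }

  self∈ : ∀ a → a ∈ mem ⟪ a ⟫
  self∈ a = 1# , sym (*-identityˡ a)

  ⟪⟫⊆ : ∀ (I : Ideal R) {a} → a ∈ mem I → mem ⟪ a ⟫ ⊆ mem I
  ⟪⟫⊆ I a∈I (r , x≈ra) = On.resp I (sym x≈ra) (On.*-closed I r a∈I)

  ⟪⟫-killed : ∀ {a z x} → z * a ≈ 0# → x ∈ mem ⟪ a ⟫ → z * x ≈ 0#
  ⟪⟫-killed {a} {z} za≈0 (r , x≈ra) =
    trans (*-congˡ x≈ra) (trans (x∙yz≈y∙xz z r a) (*-zeroʳ r za≈0))

  ⟨⟩-least : ∀ {p q} {S : Pred Carrier p} {J : Pred Carrier q} →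
             IsIdeal R J → S ⊆ J → ⟨_⟩ R S ⊆ J
  ⟨⟩-least J-ideal S⊆J = go
    where
    module J = IsIdeal J-ideal
    go : ⟨_⟩ R _ ⊆ _
    go (gen x∈S)      = S⊆J x∈S
    go zer            = J.0-mem
    go (add s t)      = J.+-closed (go s) (go t)
    go (mul r s)      = J.*-closed r (go s)
    go (Defs.resp e s) = J.resp e (go s)

  zero-isIdeal : IsIdeal R (_≈ 0#)
  zero-isIdeal = record
    { resp     = λ x≈y x≈0 → trans (sym x≈y) x≈0
    ; 0-mem    = refl
    ; +-closed = λ x≈0 y≈0 → trans (+-cong x≈0 y≈0) (+-identityʳ 0#)
    ; *-closed = λ r x≈0 → *-zeroʳ r x≈0
    }

  annIdeal : Ideal R → Ideal R
  annIdeal I = ideal (Ann R (mem I)) record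
    { resp     = λ x≈y x∈ z∈I → trans (*-congʳ (sym x≈y)) (x∈ z∈I)
    ; 0-mem    = λ {z} _ → zeroˡ z
    ; +-closed = λ {x} {y} x∈ y∈ {z} z∈I →
        trans (distribʳ z x y) (trans (+-cong (x∈ z∈I) (y∈ z∈I)) (+-identityʳ 0#))
    ; *-closed = λ r {x} x∈ {z} z∈I → trans (*-assoc r x z) (*-zeroʳ r (x∈ z∈I))
    }

  infixl 7 _⊙_
  _⊙_ : Ideal R → Ideal R → Ideal R
  I ⊙ J = ideal (_·_ R (mem I) (mem J)) record
    { resp     = Defs.resp
    ; 0-mem    = zer
    ; +-closed = add
    ; *-closed = mul
    }

  ⊙-least : ∀ {p} {K : Pred Carrier p} (I J : Ideal R) → IsIdeal R K →
            (∀ {x y} → x ∈ mem I → y ∈ mem J → x * y ∈ K) → mem (I ⊙ J) ⊆ K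
  ⊙-least I J K-ideal IJ⊆K = ⟨⟩-least K-ideal λ (x , y , x∈I , y∈J , z≈xy) →
    IsIdeal.resp K-ideal (sym z≈xy) (IJ⊆K x∈I y∈J)

  *∈⊙ : ∀ (I J : Ideal R) {x y} → x ∈ mem I → y ∈ mem J → x * y ∈ mem (I ⊙ J)
  *∈⊙ I J x∈I y∈J = gen (_ , _ , x∈I , y∈J , refl)

  ⊙⊆ˡ : ∀ (I J : Ideal R) → mem (I ⊙ J) ⊆ mem I
  ⊙⊆ˡ I J = ⊙-least I J (isIdeal I) λ {_} {y} x∈I _ → *-closedʳ I y x∈I

  Orthogonal : Ideal R → Ideal R → Set (c ⊔ ℓ)
  Orthogonal I J = ∀ {x y} → x ∈ mem I → y ∈ mem J → x * y ≈ 0#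

  orthogonal-⟪⟫ : ∀ {a b} → a * b ≈ 0# → Orthogonal ⟪ a ⟫ ⟪ b ⟫
  orthogonal-⟪⟫ {a} {b} ab≈0 {x} x∈ y∈ = ⟪⟫-killed (begin
    x * b    ≈⟨ *-comm x b ⟩
    b * x    ≈⟨ ⟪⟫-killed (trans (*-comm b a) ab≈0) x∈ ⟩
    0#       ∎) y∈

  principalVertex : ∀ {a z} → ¬ (a ≈ 0#) → ¬ (z ≈ 0#) → z * a ≈ 0# → V
  principalVertex {a} {z} a≉0 z≉0 za≈0 =
    ⟪ a ⟫ , (z , (λ x∈ → ⟪⟫-killed za≈0 x∈) , z≉0) , a , self∈ a , a≉0

  -- The two witnesses of the vertex exchange roles: the one in `I` kills Ann I, and the one killing
  -- `I` lies in Ann I.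
  annVertex : V → V
  annVertex (I , ann≠0 , x , x∈I , x≉0) =
    annIdeal I , (x , (λ {y} y∈ann → trans (*-comm x y) (y∈ann x∈I)) , x≉0) , ann≠0

  vertex-proper : ∀ v → ¬ (1# ∈ set v)
  vertex-proper (I , (z , z∈ann , z≉0) , _) 1∈I = z≉0 (trans (sym (*-identityʳ z)) (z∈ann 1∈I))

  1≉0 : V → ¬ (1# ≈ 0#)
  1≉0 (I , _ , x , _ , x≉0) 1≈0 = x≉0 (trans (sym (*-identityʳ x)) (*-zeroʳ x 1≈0))

  -- Domination and adjacency in the essential graph.

  -- The name: Ann v is contained in Ann (vw), so such a `v` is adjacent to every other vertex.
  Dominating : V → Set _
  Dominating v = Essential R (Ann R (set v))

  dominating-resp : ∀ {u v} → u ≣ v → Dominating u → Dominating v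
  dominating-resp (_ , v⊆u) = Ann-mono R v⊆u

  essential-mono : ∀ {p q} {I : Pred Carrier p} {J : Pred Carrier q} → I ⊆ J → Essential R I → Essential R J
  essential-mono I⊆J ((x , x∈I , x≉0) , meets) = (x , I⊆J x∈I , x≉0) , λ K K≠0 →
    let z , (z∈I , z∈K) , z≉0 = meets K K≠0 in z , (I⊆J z∈I , z∈K) , z≉0

  -- For z ∈ K outside Ann I, some zy with y ∈ I is a non-zero element of K ∩ Ann I.
  squareZero⇒dominating : ∀ v → Orthogonal (proj₁ v) (proj₁ v) → Dominating v
  squareZero⇒dominating (I , _ , x , x∈I , x≉0) I²≈0 =
    (x , (λ y∈I → I²≈0 x∈I y∈I) , x≉0) , meets
    where
    meets : ∀ (K : Ideal R) → NonZero R (mem K) → NonZero R (Ann R (mem I) ∩ mem K)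
    meets K (z , z∈K , z≉0) with lem {P = ∃ λ y → y ∈ mem I × ¬ (z * y ≈ 0#)}
    ... | yes (y , y∈I , zy≉0) = z * y ,
            ((λ {w} w∈I → trans (*-assoc z y w) (*-zeroʳ z (I²≈0 y∈I w∈I))) , *-closedʳ K y z∈K) , zy≉0
    ... | no  none = z , ((λ {y} y∈I → byContradiction λ zy≉0 → none (y , y∈I , zy≉0)) , z∈K) , z≉0

  dominating⇒adjacent : ∀ {u v} → Dominating u → ¬ (u ≣ v) → u ~ v
  dominating⇒adjacent {u} {v} dom u≠v = u≠v , Ann-mono R (⊙⊆ˡ (proj₁ u) (proj₁ v)) dom

  -- The product is zero, so its annihilator is the whole ring, which is essential because 1 ≠ 0.
  orthogonal⇒adjacent : ∀ {u v} → Orthogonal (proj₁ u) (proj₁ v) → ¬ (u ≣ v) → u ~ v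
  orthogonal⇒adjacent {u} {v} uv≈0 u≠v = u≠v ,
    (1# , (λ y∈ → *-zeroʳ 1# (uv⊆0 y∈)) , 1≉0 u) ,
    λ K (z , z∈K , z≉0) → z , ((λ y∈ → *-zeroʳ z (uv⊆0 y∈)) , z∈K) , z≉0
    where
    uv⊆0 : mem (proj₁ u ⊙ proj₁ v) ⊆ (_≈ 0#)
    uv⊆0 = ⊙-least (proj₁ u) (proj₁ v) zero-isIdeal uv≈0

  ann-orthogonal : ∀ v → Orthogonal (proj₁ (annVertex v)) (proj₁ v)
  ann-orthogonal v x∈ y∈ = x∈ y∈

  self-annihilator⇒dominating : ∀ v → annVertex v ≣ v → Dominating v
  self-annihilator⇒dominating v (_ , v⊆ann) =
    squareZero⇒dominating v λ x∈v y∈v → v⊆ann x∈v y∈v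

  -- Either Ann u = u, so that `u` has square zero and dominates, or `u` and Ann u are distinct
  -- vertices with product zero.
  edge-exists : ∀ {u v} → ¬ (u ≣ v) → Edge (EG R)
  edge-exists {u} {v} u≠v with lem {P = annVertex u ≣ u}
  ... | yes ann≐u = u , v , dominating⇒adjacent {u} {v} (self-annihilator⇒dominating u ann≐u) u≠v
  ... | no  ann≠u = annVertex u , u ,
          orthogonal⇒adjacent {annVertex u} {u} (ann-orthogonal u) ann≠u

  -- Two of the finitely many ideals ⟪ a ⟫, ⟪ a² ⟫, … coincide.
  finite⇒power-complement : ∀ {a n} (v : Fin n → V) → (∀ i → ∃ λ j → mem ⟪ a ^ suc i ⟫ ≐ set (v j)) →
    ∃ λ t → ∃ λ m → ∃ λ k → 1# ≈ t * a + m × m * a ^ suc k ≈ 0#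
  finite⇒power-complement {a} {n} v listed =
    let i , j , i<j , same = pigeonhole (ℕ.n<1+n n) (λ i → proj₁ (listed (toℕ i)))
        aⁱ≐aʲ : mem ⟪ a ^ suc (toℕ i) ⟫ ≐ mem ⟪ a ^ suc (toℕ j) ⟫
        aⁱ≐aʲ = ≐-trans (proj₂ (listed (toℕ i)))
          (≡.subst (λ p → set (v p) ≐ mem ⟪ a ^ suc (toℕ j) ⟫) (≡.sym same) (≐-sym (proj₂ (listed (toℕ j)))))
        d , i+d≡j = ℕ.m≤n⇒∃[o]m+o≡n i<j
        r , aⁱ≈raʲ = proj₁ aⁱ≐aʲ (self∈ (a ^ suc (toℕ i)))
        m , 1≈ , m≈ = complement (cycle (toℕ i) (toℕ j) d r i+d≡j aⁱ≈raʲ)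
    in r * a ^ d , m , toℕ i , 1≈ , m≈
    where
    -- The exponent j + 1 exceeds i + 1 by d + 1, which is at least one, so a factor `a` can be
    -- split off and `complement` applies to r aᵈ a.
    cycle : ∀ i j d r → suc i ℕ.+ d ≡ j → a ^ suc i ≈ r * a ^ suc j →
            a ^ suc i ≈ (r * a ^ d * a) * a ^ suc i
    cycle i j d r i+d≡j aⁱ≈raʲ = begin
      a ^ suc i                          ≈⟨ aⁱ≈raʲ ⟩
      r * a ^ suc j                      ≈⟨ *-congˡ (^-congʳ a 1+j≡) ⟩
      r * a ^ (suc i ℕ.+ suc d)          ≈⟨ *-congˡ (^-homo-* a (suc i) (suc d)) ⟩
      r * (a ^ suc i * (a * a ^ d))      ≈⟨ *-congˡ (x∙yz≈zy∙x (a ^ suc i) a (a ^ d)) ⟩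
      r * ((a ^ d * a) * a ^ suc i)      ≈⟨ *-assoc r (a ^ d * a) (a ^ suc i) ⟨
      (r * (a ^ d * a)) * a ^ suc i      ≈⟨ *-congʳ (*-assoc r (a ^ d) a) ⟨
      (r * a ^ d * a) * a ^ suc i        ∎
      where
      1+j≡ : suc j ≡ suc i ℕ.+ suc d
      1+j≡ = ≡.trans (≡.cong suc (≡.sym i+d≡j)) (≡.sym (ℕ.+-suc (suc i) d))

  -- Rings that are not reduced

  module NonReduced (tf : TriangleFree (EG R)) {y} (y≉0 : ¬ (y ≈ 0#)) (y²≈0 : y * y ≈ 0#) where

    Y : V
    Y = principalVertex y≉0 y≉0 y²≈0

    Y-dominating : Dominating Y
    Y-dominating = squareZero⇒dominating Y (orthogonal-⟪⟫ y²≈0)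

    -- A vertex v other than `Y` is adjacent to Ann v, so Ann v must be `Y` to avoid a triangle. A
    -- non-zero ideal inside `Y` has square zero, hence dominates and equals `Y`. Were `Y`
    -- essential, so would be Ann w, and `w` would dominate.
    uniqueDominating⇒NonEssentialMinimal :
      (∀ v → Dominating v → v ≣ Y) → ∀ {w} → ¬ (w ≣ Y) → NonEssentialMinimalSquareZero R
    uniqueDominating⇒NonEssentialMinimal unique {w} w≠Y =
      proj₁ Y , (proj₂ (proj₂ Y) , minimal) , not-essential , square-zero′ , ann≐Y
      where
      ann≣Y : ∀ v → ¬ (v ≣ Y) → annVertex v ≣ Y
      ann≣Y v v≠Y = byContradiction λ ann≠Y →
        tf Y v (annVertex v)
          (dominating⇒adjacent {Y} {v} Y-dominating (v≠Y ∘ ≐-sym))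
          (~-sym {annVertex v} {v} (orthogonal⇒adjacent {annVertex v} {v} (ann-orthogonal v)
            λ ann≣v → v≠Y (unique v (self-annihilator⇒dominating v ann≣v))))
          (dominating⇒adjacent {Y} {annVertex v} Y-dominating (ann≠Y ∘ ≐-sym))
      minimal : ∀ (J : Ideal R) → NonZero R (mem J) → mem J ⊆ mem ⟪ y ⟫ → mem ⟪ y ⟫ ⊆ mem J
      minimal J J≠0 J⊆Y = proj₂ (unique v (squareZero⇒dominating v J²≈0))
        where
        v : V
        v = J , (y , (λ x∈J → ⟪⟫-killed y²≈0 (J⊆Y x∈J)) , y≉0) , J≠0
        J²≈0 : Orthogonal J J
        J²≈0 a∈J b∈J = orthogonal-⟪⟫ y²≈0 (J⊆Y a∈J) (J⊆Y b∈J)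
      not-essential : ¬ Essential R (mem ⟪ y ⟫)
      not-essential ess = w≠Y (unique w (essential-mono (proj₂ (ann≣Y w w≠Y)) ess))
      square-zero′ : IsZero R (mem (⟪ y ⟫ ⊙ ⟪ y ⟫))
      square-zero′ = ⊙-least ⟪ y ⟫ ⟪ y ⟫ zero-isIdeal (orthogonal-⟪⟫ y²≈0)
      ann≐Y : ∀ (J : Ideal R) → NonZero R (mem J) → Annihilating R (mem J) →
              ¬ (mem J ≐ mem ⟪ y ⟫) → Ann R (mem J) ≐ mem ⟪ y ⟫
      ann≐Y J J≠0 J-ann = ann≣Y (J , J-ann , J≠0)

    twoDominating⇒exhaustive : ∀ {u} → Dominating u → ¬ (u ≣ Y) → ∀ v → v ≣ Y ⊎ v ≣ u
    twoDominating⇒exhaustive {u} u-dom u≠Y v with lem {P = v ≣ Y} | lem {P = v ≣ u}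
    ... | yes v≣Y | _       = inj₁ v≣Y
    ... | no  _   | yes v≣u = inj₂ v≣u
    ... | no  v≠Y | no  v≠u = ⊥-elim (tf Y u v
            (dominating⇒adjacent {Y} {u} Y-dominating (u≠Y ∘ ≐-sym))
            (dominating⇒adjacent {u} {v} u-dom (v≠u ∘ ≐-sym))
            (dominating⇒adjacent {Y} {v} Y-dominating (v≠Y ∘ ≐-sym)))

  -- Rings with exactly two vertices, one of square zero.

  -- For non-zero `a` this says, in terms of elements, that `⟪ a ⟫` is a minimal ideal.
  Simple : Carrier → Set (c ⊔ ℓ)
  Simple a = ∀ {b} → b ∈ mem ⟪ a ⟫ → ¬ (b ≈ 0#) → a ∈ mem ⟪ b ⟫

  -- Since za generates `⟪ a ⟫`, some `t` has a = tza, so `t` inverts `z` modulo Ann a: the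
  -- annihilator is a maximal ideal.
  simple⇒ann-maximal : ∀ {a} → Simple a → ∀ {z} → ¬ (z * a ≈ 0#) →
                       ∃ λ t → ∃ λ m → 1# ≈ t * z + m × m * a ≈ 0#
  simple⇒ann-maximal {a} simple {z} za≉0 =
    let t , a≈tza = simple (z , refl) za≉0
        m , 1≈ , ma≈0 = complement (trans a≈tza (sym (*-assoc t z a)))
    in t , m , 1≈ , ma≈0

  -- If `⟪ y ⟫` is not simple, it strictly contains a non-zero `⟪ a ⟫`. This and every non-zero
  -- principal ideal inside it miss `y`, so all of them are the other vertex, and `a` is simple.
  simple-of-two : ∀ {y} → (y≉0 : ¬ (y ≈ 0#)) (y²≈0 : y * y ≈ 0#) → let Y = principalVertex y≉0 y≉0 y²≈0 in
    ∀ {u} → ¬ (u ≣ Y) → (∀ v → v ≣ Y ⊎ v ≣ u) →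
    ∃ λ a → Σ (¬ (a ≈ 0#)) λ a≉0 → Σ (a * a ≈ 0#) λ a²≈0 → Simple a ×
      ∃ λ B → ¬ (B ≣ principalVertex a≉0 a≉0 a²≈0) ×
        (∀ v → v ≣ principalVertex a≉0 a≉0 a²≈0 ⊎ v ≣ B)
  simple-of-two {y} y≉0 y²≈0 {u} u≠Y two
    with lem {P = ∃ λ a → a ∈ mem ⟪ y ⟫ × ¬ (a ≈ 0#) × ¬ (y ∈ mem ⟪ a ⟫)}
  ... | no none = y , y≉0 , y²≈0 ,
          (λ {b} b∈ b≉0 → byContradiction λ y∉ → none (b , b∈ , b≉0 , y∉)) , u , u≠Y , two
  ... | yes (a , a∈ , a≉0 , y∉) = a , a≉0 , a²≈0 , simple , Y ,
          (λ Y≣A → y∉ (proj₁ Y≣A (self∈ y))) , λ v → swap (relabel {v} (two v))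
    where
    Y A : V
    Y = principalVertex y≉0 y≉0 y²≈0
    square-zero-in-Y : ∀ {b} → b ∈ mem ⟪ y ⟫ → b * b ≈ 0#
    square-zero-in-Y b∈ = orthogonal-⟪⟫ y²≈0 b∈ b∈
    a²≈0 : a * a ≈ 0#
    a²≈0 = square-zero-in-Y a∈
    A = principalVertex a≉0 a≉0 a²≈0
    ≣u : ∀ v → ¬ (y ∈ set v) → v ≣ u
    ≣u v y∉v with two v
    ... | inj₁ v≣Y = ⊥-elim (y∉v (proj₂ v≣Y (self∈ y)))
    ... | inj₂ v≣u = v≣u
    relabel : ∀ {v} → v ≣ Y ⊎ v ≣ u → v ≣ Y ⊎ v ≣ A
    relabel (inj₁ v≣Y) = inj₁ v≣Y
    relabel (inj₂ v≣u) = inj₂ (≐-trans v≣u (≐-sym (≣u A y∉)))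
    simple : Simple a
    simple {b} b∈A b≉0 = proj₂ (≐-trans (≣u B (y∉ ∘ ⟪⟫⊆ ⟪ a ⟫ b∈A)) (≐-sym (≣u A y∉))) (self∈ a)
      where
      B : V
      B = principalVertex b≉0 b≉0 (square-zero-in-Y (⟪⟫⊆ ⟪ y ⟫ a∈ b∈A))

  -- Modulo `K` the element `m` equals 1, but its cube is zero; `lift-power` cancels one factor `m`
  -- at a time.
  nilpotent-complement : ∀ (K : Ideal R) {u m} → 1# ≈ u + m → u ∈ mem K → m * (m * m) ≈ 0# → 1# ∈ mem K
  nilpotent-complement K {u} {m} 1≈u+m u∈K m³≈0 =
    lift-power 1# (*-one m (lift-power m (lift-power (m * m) (On.resp K (sym m³≈0) (On.0-mem K)))))
    where
    lift-power : ∀ x → m * x ∈ mem K → x ∈ mem K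
    lift-power x mx∈K = On.resp K (sym (decompose 1≈u+m x)) (On.+-closed K (*-closedʳ K x u∈K) mx∈K)
    *-one : ∀ x → x ∈ mem K → x * 1# ∈ mem K
    *-one x = On.resp K (sym (*-identityʳ x))

  -- Here Ann a = `⟪ x ⟫` strictly contains the simple ideal `⟪ a ⟫`, and these are the only
  -- non-zero ideals inside Ann a. The aim is to recognise `⟪ x ⟫` as the nilradical and `⟪ a ⟫` =
  -- `⟪ x * x ⟫` as its square.
  module TwoIdeals {a x} (a≉0 : ¬ (a ≈ 0#)) (a²≈0 : a * a ≈ 0#) (simple : Simple a)
                   (x∉A : ¬ (x ∈ mem ⟪ a ⟫)) (xa≈0 : x * a ≈ 0#)
                   (ann⊆X : ∀ {z} → z * a ≈ 0# → z ∈ mem ⟪ x ⟫)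
                   (two : ∀ (J : Ideal R) → NonZero R (mem J) → (∀ {z} → z ∈ mem J → z * a ≈ 0#) →
                          mem J ≐ mem ⟪ a ⟫ ⊎ mem J ≐ mem ⟪ x ⟫) where

    x≉0 : ¬ (x ≈ 0#)
    x≉0 x≈0 = x∉A (On.resp ⟪ a ⟫ (sym x≈0) (On.0-mem ⟪ a ⟫))

    X⊆ann : ∀ {z} → z ∈ mem ⟪ x ⟫ → a * z ≈ 0#
    X⊆ann = ⟪⟫-killed (trans (*-comm a x) xa≈0)

    1∉ : ∀ {z} → a * z ≈ 0# → ¬ (1# ∈ mem ⟪ z ⟫)
    1∉ az≈0 1∈Z = a≉0 (trans (sym (*-identityʳ a)) (⟪⟫-killed az≈0 1∈Z))

    -- Write a = rx. If x² = 0, then r lies outside Ann a = `⟪ x ⟫`, as otherwise a = 0; so r is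
    -- invertible modulo Ann a, which kills `x`, and `x` becomes a multiple of `a`.
    x²≉0 : ¬ (x * x ≈ 0#)
    x²≉0 x²≈0 =
      let r , a≈rx = ann⊆X a²≈0
          ra≉0 = λ ra≈0 → a≉0 (trans a≈rx (orthogonal-⟪⟫ x²≈0 (ann⊆X ra≈0) (self∈ x)))
          t , m , 1≈tr+m , ma≈0 = simple⇒ann-maximal simple ra≉0
      in x∉A (t , (begin
           x              ≈⟨ decompose-killed 1≈tr+m (orthogonal-⟪⟫ x²≈0 (ann⊆X ma≈0) (self∈ x)) ⟩
           t * r * x      ≈⟨ *-assoc t r x ⟩
           t * (r * x)    ≈⟨ *-congˡ a≈rx ⟨
           t * a          ∎))

    -- The non-zero ideal `⟪ x * x ⟫` is one of the two. It is not `⟪ x ⟫`: from x = sx² and a = rx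
    -- would follow a = a(sx) = 0.
    X²≐A : mem ⟪ x * x ⟫ ≐ mem ⟪ a ⟫
    X²≐A = fromInj₁ (λ X²≐X → ⊥-elim (X²≠X X²≐X)) (two ⟪ x * x ⟫ (x * x , self∈ (x * x) , x²≉0)
             λ {z} z∈X² → trans (*-comm z a) (⟪⟫-killed (X⊆ann (x , refl)) z∈X²))
      where
      X²≠X : ¬ (mem ⟪ x * x ⟫ ≐ mem ⟪ x ⟫)
      X²≠X X²≐X =
        let s , x≈sx² = proj₂ X²≐X (self∈ x)
            r , a≈rx  = ann⊆X a²≈0
        in a≉0 (begin
             a                  ≈⟨ a≈rx ⟩
             r * x              ≈⟨ *-congˡ x≈sx² ⟩
             r * (s * (x * x))  ≈⟨ *-congˡ (x∙yz≈y∙xz s x x) ⟩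
             r * (x * (s * x))  ≈⟨ *-assoc r x (s * x) ⟨
             r * x * (s * x)    ≈⟨ *-congʳ a≈rx ⟨
             a * (s * x)        ≈⟨ X⊆ann (s , refl) ⟩
             0#                 ∎)

    x^3≈0 : x ^ 3 ≈ 0#
    x^3≈0 = trans (*-congˡ (*-congˡ (*-identityʳ x))) (⟪⟫-killed xa≈0 (proj₁ X²≐A (self∈ (x * x))))

    X-nilpotent : ∀ {z} → z ∈ mem ⟪ x ⟫ → z ^ 3 ≈ 0#
    X-nilpotent {z} (r , z≈rx) =
      trans (^-congˡ 3 z≈rx) (trans (^-distrib-* r x 3) (*-zeroʳ (r ^ 3) x^3≈0))

    -- Ann a is maximal, hence contains no power of an element outside it; this places all
    -- nilpotents in Ann a = `⟪ x ⟫`.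
    powers-act : ∀ {z} → ¬ (z * a ≈ 0#) → ∀ n → ¬ (z ^ n * a ≈ 0#)
    powers-act za≉0 zero 1a≈0 = a≉0 (trans (sym (*-identityˡ a)) 1a≈0)
    powers-act {z} za≉0 (suc n) zzⁿa≈0 =
      let t , m , 1≈tz+m , ma≈0 = simple⇒ann-maximal simple za≉0
      in powers-act za≉0 n (begin
           z ^ n * a                ≈⟨ decompose-killed 1≈tz+m (⟪⟫-killed ma≈0 (z ^ n , refl)) ⟩
           t * z * (z ^ n * a)      ≈⟨ *-assoc t z (z ^ n * a) ⟩
           t * (z * (z ^ n * a))    ≈⟨ *-zeroʳ t (trans (sym (*-assoc z (z ^ n) a)) zzⁿa≈0) ⟩
           0#                       ∎)

    Nil≐X : Nil R ≐ mem ⟪ x ⟫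
    Nil≐X = (λ (n , zⁿ≈0) → ann⊆X (byContradiction λ za≉0 → powers-act za≉0 n (*-zeroˡ a zⁿ≈0))) ,
            λ z∈X → 3 , X-nilpotent z∈X

    Nil²≐A : _·_ R (Nil R) (Nil R) ≐ mem ⟪ a ⟫
    Nil²≐A = ⟨⟩-least (isIdeal ⟪ a ⟫) products , λ (r , z≈ra) → Defs.resp (sym z≈ra) (mul r a∈Nil²)
      where
      products : (λ z → ∃₂ λ b d → b ∈ Nil R × d ∈ Nil R × z ≈ b * d) ⊆ mem ⟪ a ⟫
      products {z} (b , d , b∈Nil , d∈Nil , z≈bd) =
        let r , b≈rx = proj₁ Nil≐X b∈Nil
            s , d≈sx = proj₁ Nil≐X d∈Nil
        in On.resp ⟪ a ⟫ (begin
             r * s * (x * x)    ≈⟨ interchange r s x x ⟩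
             r * x * (s * x)    ≈⟨ *-cong b≈rx d≈sx ⟨
             b * d              ≈⟨ z≈bd ⟨
             z                  ∎) (On.*-closed ⟪ a ⟫ (r * s) (proj₁ X²≐A (self∈ (x * x))))
      a∈Nil² : a ∈ _·_ R (Nil R) (Nil R)
      a∈Nil² = let p , a≈px² = proj₂ X²≐A (self∈ a)
               in Defs.resp (sym a≈px²) (mul p (gen (x , x , (3 , x^3≈0) , (3 , x^3≈0) , refl)))

    -- A proper ideal lies inside Ann a, where `two` applies: an element z outside would give 1 = tz
    -- + m with m in `⟪ x ⟫` of cube zero.
    classify : ∀ (K : Ideal R) → NonTrivial R (mem K) → mem K ≐ Nil R ⊎ mem K ≐ _·_ R (Nil R) (Nil R)
    classify K (K≠0 , K-proper) = swap (Sum.map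
      (λ K≐A → ≐-trans K≐A (≐-sym Nil²≐A)) (λ K≐X → ≐-trans K≐X (≐-sym Nil≐X)) (two K K≠0 killed))
      where
      killed : ∀ {z} → z ∈ mem K → z * a ≈ 0#
      killed {z} z∈K = byContradiction λ za≉0 →
        let t , m , 1≈tz+m , ma≈0 = simple⇒ann-maximal simple za≉0
        in 1∉proper K K-proper (nilpotent-complement K 1≈tz+m (On.*-closed K t z∈K)
             (trans (*-congˡ (*-congˡ (sym (*-identityʳ m)))) (X-nilpotent (ann⊆X ma≈0))))

    exactlyNilAndNilSquared : ExactlyNilAndNilSquared R
    exactlyNilAndNilSquared =
      ((x , (3 , x^3≈0) , x≉0) , λ all → 1∉ (X⊆ann (self∈ x)) (proj₁ Nil≐X (all 1#))) ,
      ((a , proj₂ Nil²≐A (self∈ a) , a≉0) , λ all → 1∉ a²≈0 (proj₁ Nil²≐A (all 1#))) ,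
      (λ Nil≐Nil² → x∉A (proj₁ Nil²≐A (proj₁ Nil≐Nil² (3 , x^3≈0)))) ,
      classify

  -- As `A` is simple and differs from `B`, some `x` in `B` lies outside `A`. Both Ann a and `⟪ x ⟫`
  -- then have to be `B`, which is the setting of `TwoIdeals`.
  twoVertices⇒ExactlyNilAndNilSquared : ∀ {a} (a≉0 : ¬ (a ≈ 0#)) (a²≈0 : a * a ≈ 0#) → Simple a →
    let A = principalVertex a≉0 a≉0 a²≈0 in
    ∀ {B} → ¬ (B ≣ A) → (∀ v → v ≣ A ⊎ v ≣ B) → ExactlyNilAndNilSquared R
  twoVertices⇒ExactlyNilAndNilSquared {a} a≉0 a²≈0 simple {B} B≠A two =
    let x , x∈B , x∉A = ⊈⇒∃ B⊈A in conclude x∈B x∉A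
    where
    A M : V
    A = principalVertex a≉0 a≉0 a²≈0
    M = annVertex A
    A⊆ : ∀ v {b} → b ∈ mem ⟪ a ⟫ → ¬ (b ≈ 0#) → b ∈ set v → mem ⟪ a ⟫ ⊆ set v
    A⊆ v b∈A b≉0 b∈v = ⟪⟫⊆ (proj₁ v) (⟪⟫⊆ (proj₁ v) b∈v (simple b∈A b≉0))
    B⊈A : ¬ (set B ⊆ mem ⟪ a ⟫)
    B⊈A B⊆A = let b , b∈B , b≉0 = proj₂ (proj₂ B)
              in B≠A (B⊆A , A⊆ B (B⊆A b∈B) b≉0 b∈B)
    ∈M : ∀ {z} → z * a ≈ 0# → z ∈ set M
    ∈M za≈0 z∈A = ⟪⟫-killed za≈0 z∈A
    -- If Ann a were `A`, then xa ≠ 0 would lie in both vertices, so `B` contains `A`; with 1 = tx +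
    -- m and m in Ann a = `A`, the vertex `B` would contain 1.
    M≣B : ∀ {x} → x ∈ set B → ¬ (x ∈ mem ⟪ a ⟫) → M ≣ B
    M≣B {x} x∈B x∉A = fromInj₂ (λ M≣A →
      let xa≉0 = λ xa≈0 → x∉A (proj₁ M≣A (∈M xa≈0))
          t , m , 1≈tx+m , ma≈0 = simple⇒ann-maximal simple xa≉0
          A⊆B = A⊆ B (x , refl) xa≉0 (*-closedʳ (proj₁ B) a x∈B)
      in ⊥-elim (vertex-proper B (On.resp (proj₁ B) (sym 1≈tx+m)
           (On.+-closed (proj₁ B) (On.*-closed (proj₁ B) t x∈B) (A⊆B (proj₁ M≣A (∈M ma≈0)))))))
      (two M)
    conclude : ∀ {x} → x ∈ set B → ¬ (x ∈ mem ⟪ a ⟫) → ExactlyNilAndNilSquared R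
    conclude {x} x∈B x∉A = TwoIdeals.exactlyNilAndNilSquared a≉0 a²≈0 simple x∉A xa≈0 ann⊆X two′
      where
      xa≈0 : x * a ≈ 0#
      xa≈0 = proj₂ (M≣B x∈B x∉A) x∈B (self∈ a)
      x≉0 : ¬ (x ≈ 0#)
      x≉0 x≈0 = x∉A (On.resp ⟪ a ⟫ (sym x≈0) (On.0-mem ⟪ a ⟫))
      X : V
      X = principalVertex x≉0 a≉0 (trans (*-comm a x) xa≈0)
      X≣B : X ≣ B
      X≣B = fromInj₂ (λ X≣A → ⊥-elim (x∉A (proj₁ X≣A (self∈ x)))) (two X)
      ann⊆X : ∀ {z} → z * a ≈ 0# → z ∈ mem ⟪ x ⟫
      ann⊆X za≈0 = proj₂ X≣B (proj₁ (M≣B x∈B x∉A) (∈M za≈0))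
      two′ : ∀ (J : Ideal R) → NonZero R (mem J) → (∀ {z} → z ∈ mem J → z * a ≈ 0#) →
             mem J ≐ mem ⟪ a ⟫ ⊎ mem J ≐ mem ⟪ x ⟫
      two′ J J≠0 killed = Sum.map₂ (λ J≣B → ≐-trans J≣B (≐-sym X≣B))
        (two (J , (a , (λ {z} z∈J → trans (*-comm a z) (killed z∈J)) , a≉0) , J≠0))

  nonReduced⇒ : TriangleFree (EG R) → ∀ {v w} → ¬ (v ≣ w) → ¬ Reduced R →
                ExactlyNilAndNilSquared R ⊎ NonEssentialMinimalSquareZero R
  nonReduced⇒ tf {v} {w} v≠w not-reduced =
    let x , (n , xⁿ≈0) , x≉0 = ¬IsZero⇒NonZero not-reduced
        y , y≉0 , y²≈0 = square-zero x≉0 n xⁿ≈0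
    in split y≉0 y²≈0
    where
    split : ∀ {y} → ¬ (y ≈ 0#) → y * y ≈ 0# → ExactlyNilAndNilSquared R ⊎ NonEssentialMinimalSquareZero R
    split {y} y≉0 y²≈0 with lem {P = ∃ λ u → Dominating u × ¬ (u ≣ principalVertex y≉0 y≉0 y²≈0)}
    ... | yes (u , u-dom , u≠Y) =
      let a , a≉0 , a²≈0 , simple , B , B≠A , two =
            simple-of-two y≉0 y²≈0 {u} u≠Y (twoDominating⇒exhaustive {u} u-dom u≠Y)
      in inj₁ (twoVertices⇒ExactlyNilAndNilSquared a≉0 a²≈0 simple {B} B≠A two)
      where open NonReduced tf y≉0 y²≈0
    ... | no none = inj₂ (uniqueDominating⇒NonEssentialMinimal unique {proj₁ other} (proj₂ other))
      where
      open NonReduced tf y≉0 y²≈0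
      unique : ∀ u → Dominating u → u ≣ Y
      unique u u-dom = byContradiction λ u≠Y → none (u , u-dom , u≠Y)
      other : ∃ λ w → ¬ (w ≣ Y)
      other with lem {P = v ≣ Y}
      ... | yes v≣Y = w , λ w≣Y → v≠w (≐-trans v≣Y (≐-sym w≣Y))
      ... | no  v≠Y = v , v≠Y

  -- Reduced rings

  reduced⇒square : Reduced R → ∀ {x} → x * x ≈ 0# → x ≈ 0#
  reduced⇒square reduced {x} x²≈0 = reduced (2 , trans (*-congˡ (*-identityʳ x)) x²≈0)

  -- A non-zero ab would have a non-zero multiple w in the essential ideal Ann (uv). Then w kills
  -- ab, hence itself, so w² = 0.
  reduced-adjacent⇒orthogonal : Reduced R → ∀ {u v} → u ~ v → Orthogonal (proj₁ u) (proj₁ v)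
  reduced-adjacent⇒orthogonal reduced {u} {v} (_ , _ , meets) {a} {b} a∈u b∈v =
    byContradiction λ ab≉0 →
      let w , (w∈ann , r , w≈rab) , w≉0 = meets ⟪ a * b ⟫ (a * b , self∈ (a * b) , ab≉0)
      in w≉0 (reduced⇒square reduced (begin
           w * w              ≈⟨ *-congˡ w≈rab ⟩
           w * (r * (a * b))  ≈⟨ ⟪⟫-killed (w∈ann (*∈⊙ (proj₁ u) (proj₁ v) a∈u b∈v)) (r , refl) ⟩
           0#                 ∎))

  -- Distinctness is automatic: equal orthogonal vertices would have square zero.
  reduced-orthogonal⇒adjacent : Reduced R → ∀ {u v} → Orthogonal (proj₁ u) (proj₁ v) → u ~ v
  reduced-orthogonal⇒adjacent reduced {u} {v} uv≈0 =
    orthogonal⇒adjacent {u} {v} uv≈0 λ (u⊆v , _) →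
      let x , x∈u , x≉0 = proj₂ (proj₂ u)
      in x≉0 (reduced⇒square reduced (uv≈0 x∈u (u⊆v x∈u)))

  -- If xy ∈ Ann I but x, y ∉ Ann I, pick a, b ∈ I with xa, yb ≠ 0:
  -- then ⟪ xa ⟫, ⟪ yb ⟫ and Ann I form a triangle.
  ann-prime : Reduced R → TriangleFree (EG R) → (v : V) → Prime R (annIdeal (proj₁ v))
  ann-prime reduced tf v@(I , (p , p∈ann , p≉0) , I≠0) = (λ all → vertex-proper (annVertex v) (all 1#)) , split
    where
    split : ∀ {x y} → x * y ∈ Ann R (mem I) → x ∈ Ann R (mem I) ⊎ y ∈ Ann R (mem I)
    split {x} {y} xy∈ann with lem {P = x ∈ Ann R (mem I)} | lem {P = y ∈ Ann R (mem I)}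
    ... | yes x∈ann | _         = inj₁ x∈ann
    ... | no  _     | yes y∈ann = inj₂ y∈ann
    ... | no  x∉ann | no  y∉ann =
      ⊥-elim (x∉ann λ {a} a∈I → byContradiction λ xa≉0 →
              y∉ann λ {b} b∈I → byContradiction λ yb≉0 → triangle a∈I b∈I xa≉0 yb≉0)
      where
      p-kills : ∀ {a} x → a ∈ mem I → p * (x * a) ≈ 0#
      p-kills x a∈I = p∈ann (On.*-closed I x a∈I)
      triangle : ∀ {a b} → a ∈ mem I → b ∈ mem I → ¬ (x * a ≈ 0#) → ¬ (y * b ≈ 0#) → ⊥
      triangle {a} {b} a∈I b∈I xa≉0 yb≉0 = tf XA YB (annVertex v)
        (reduced-orthogonal⇒adjacent reduced {XA} {YB} (orthogonal-⟪⟫ (begin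
          x * a * (y * b)    ≈⟨ interchange x a y b ⟩
          x * y * (a * b)    ≈⟨ xy∈ann (On.*-closed I a b∈I) ⟩
          0#                 ∎)))
        (reduced-orthogonal⇒adjacent reduced {YB} {annVertex v} (⊥ann yb∈I))
        (reduced-orthogonal⇒adjacent reduced {XA} {annVertex v} (⊥ann xa∈I))
        where
        XA YB : V
        XA = principalVertex xa≉0 p≉0 (p-kills x a∈I)
        YB = principalVertex yb≉0 p≉0 (p-kills y b∈I)
        xa∈I : x * a ∈ mem I
        xa∈I = On.*-closed I x a∈I
        yb∈I : y * b ∈ mem I
        yb∈I = On.*-closed I y b∈I
        ⊥ann : ∀ {z} → z ∈ mem I → Orthogonal ⟪ z ⟫ (annIdeal I)
        ⊥ann z∈I {s} {q} s∈Z q∈ann = trans (*-comm s q) (q∈ann (⟪⟫⊆ I z∈I s∈Z))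

  prime-^ : ∀ {P} → Prime R P → ∀ n {x} → x ^ n ∈ mem P → x ∈ mem P
  prime-^ {P} (proper , _) zero    1∈P  = ⊥-elim (1∉proper P proper 1∈P)
  prime-^ {P} prime        (suc n) xⁿ∈P = [ id , prime-^ {P} prime n ] (proj₂ prime xⁿ∈P)

  -- Two non-zero primes meeting in zero.

  -- The common form of the three reduced cases of the classification; `P` and `Q` turn out to be
  -- the minimal primes.
  record TwoPrimes (P Q : Ideal R) : Set (c ⊔ ℓ) where
    field
      P-prime : Prime R P
      Q-prime : Prime R Q
      P≠0     : NonZero R (mem P)
      Q≠0     : NonZero R (mem Q)
      P∩Q≈0   : ∀ {x} → x ∈ mem P → x ∈ mem Q → x ≈ 0#

  TwoPrimes-sym : ∀ {P Q} → TwoPrimes P Q → TwoPrimes Q P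
  TwoPrimes-sym tp = record
    { P-prime = Q-prime ; Q-prime = P-prime ; P≠0 = Q≠0 ; Q≠0 = P≠0
    ; P∩Q≈0   = λ x∈Q x∈P → P∩Q≈0 x∈P x∈Q }
    where open TwoPrimes tp

  reduced⇒TwoPrimes : Reduced R → TriangleFree (EG R) → V → ∃₂ TwoPrimes
  reduced⇒TwoPrimes reduced tf v = proj₁ (annVertex v) , proj₁ (annVertex (annVertex v)) , record
    { P-prime = ann-prime reduced tf v
    ; Q-prime = ann-prime reduced tf (annVertex v)
    ; P≠0     = proj₁ (proj₂ v)
    ; Q≠0     = proj₁ (proj₂ (annVertex v))
    ; P∩Q≈0   = λ x∈P x∈Q → reduced⇒square reduced (x∈Q x∈P)
    }

  module OneSide {P Q} (tp : TwoPrimes P Q) where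
    open TwoPrimes tp

    products-vanish : ∀ {x y} → x ∈ mem P → y ∈ mem Q → x * y ≈ 0#
    products-vanish {x} {y} x∈P y∈Q = P∩Q≈0 (*-closedʳ P y x∈P) (On.*-closed Q x y∈Q)

    ∈P⇒∉Q : ∀ {x} → x ∈ mem P → ¬ (x ≈ 0#) → ¬ (x ∈ mem Q)
    ∈P⇒∉Q x∈P x≉0 x∈Q = x≉0 (P∩Q≈0 x∈P x∈Q)

    ∈Q⇒∉P : ∀ {x} → x ∈ mem Q → ¬ (x ≈ 0#) → ¬ (x ∈ mem P)
    ∈Q⇒∉P x∈Q x≉0 x∈P = x≉0 (P∩Q≈0 x∈P x∈Q)

    cancelQ : ∀ {x y} → x * y ≈ 0# → ¬ (x ∈ mem Q) → y ∈ mem Q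
    cancelQ xy≈0 x∉Q =
      fromInj₂ (⊥-elim ∘ x∉Q) (proj₂ Q-prime (On.resp Q (sym xy≈0) (On.0-mem Q)))

    reduced : Reduced R
    reduced (n , xⁿ≈0) = P∩Q≈0 (prime-^ {P} P-prime n (On.resp P (sym xⁿ≈0) (On.0-mem P)))
                               (prime-^ {Q} Q-prime n (On.resp Q (sym xⁿ≈0) (On.0-mem Q)))

    -- A prime inside `P` misses a non-zero element of `Q`, and that element kills all of `P`.
    minimal : MinimalPrime R P
    minimal = P-prime , λ T T-prime T⊆P {x} x∈P →
      let q , q∈Q , q≉0 = Q≠0
      in fromInj₁ (λ q∈T → ⊥-elim (∈Q⇒∉P q∈Q q≉0 (T⊆P q∈T)))
           (proj₂ T-prime (On.resp T (sym (products-vanish x∈P q∈Q)) (On.0-mem T)))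

    -- `Lift` raises the inclusion to the level of the edge relation, where the parts of a
    -- bipartition live.
    Side : Pred V (Level.suc (c ⊔ ℓ))
    Side v = Lift _ (set v ⊆ mem P)

    Side-resp : ∀ {u v} → u ≣ v → u ∈ Side → v ∈ Side
    Side-resp (_ , v⊆u) (lift u⊆P) = lift (u⊆P ∘ v⊆u)

    Side-indep : ∀ {u v} → u ∈ Side → v ∈ Side → ¬ (u ~ v)
    Side-indep {u} {v} (lift u⊆P) (lift v⊆P) u~v =
      let a , a∈u , a≉0 = proj₂ (proj₂ u)
          b , b∈v , b≉0 = proj₂ (proj₂ v)
          ab≈0 = reduced-adjacent⇒orthogonal reduced {u} {v} u~v a∈u b∈v
      in ∈P⇒∉Q (v⊆P b∈v) b≉0 (cancelQ ab≈0 (∈P⇒∉Q (u⊆P a∈u) a≉0))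

    inP : ∀ J → NonZero R (mem J) → mem J ⊆ mem P → V
    inP J J≠0 J⊆P =
      let q , q∈Q , q≉0 = Q≠0
      in J , (q , (λ {x} x∈J → trans (*-comm q x) (products-vanish (J⊆P x∈J) q∈Q)) , q≉0) , J≠0

    PV : V
    PV = inP P P≠0 (λ x∈ → x∈)

    -- Coinciding powers give 1 = ta + m, where m kills a power of `a` and so lies in `Q`. Hence m
    -- kills each b in `P`, and b = tab.
    finite⇒principal : ∀ {n} → HasSize (EG R) Side n → ∀ {a} → a ∈ mem P → ¬ (a ≈ 0#) → mem P ⊆ mem ⟪ a ⟫
    finite⇒principal (v , _ , _ , covers) {a} a∈P a≉0 {b} b∈P =
      let t , m , k , 1≈ta+m , maᵏ≈0 = finite⇒power-complement v λ i → covers {w i} (lift (power⊆P i))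
          m∈Q = cancelQ (trans (*-comm (a ^ suc k) m) maᵏ≈0)
                  λ aᵏ∈Q → ∈P⇒∉Q a∈P a≉0 (prime-^ {Q} Q-prime (suc k) aᵏ∈Q)
      in t * b , trans (decompose-killed 1≈ta+m (trans (*-comm m b) (products-vanish b∈P m∈Q))) (xy∙z≈xz∙y t a b)
      where
      power⊆P : ∀ i → mem ⟪ a ^ suc i ⟫ ⊆ mem P
      power⊆P i = ⟪⟫⊆ P (*-closedʳ P (a ^ i) a∈P)
      w : ℕ → V
      w i = inP ⟪ a ^ suc i ⟫ (a ^ suc i , self∈ (a ^ suc i) , λ aⁱ≈0 → a≉0 (reduced (suc i , aⁱ≈0))) (power⊆P i)

    one-or-infinite : PartSize (EG R) Side (fin 1) ⊎ PartSize (EG R) Side ∞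
    one-or-infinite with lem {P = ∃ (HasSize (EG R) Side)}
    ... | no  infinite     = inj₂ λ n size → infinite (n , size)
    ... | yes (n , finite) = inj₁ (hasSize-1 (EG R) {v = PV} (lift (λ {_} x∈ → x∈)) λ {u} (lift u⊆P) →
            let a , a∈u , a≉0 = proj₂ (proj₂ u)
            in u⊆P , λ x∈P → ⟪⟫⊆ (proj₁ u) a∈u (finite⇒principal finite (u⊆P a∈u) a≉0 x∈P))

  K₁₁⊎K₁∞⊎K∞∞ : Set _
  K₁₁⊎K₁∞⊎K∞∞ = IsK (EG R) (fin 1) (fin 1) ⊎ IsK (EG R) (fin 1) ∞ ⊎ IsK (EG R) ∞ ∞

  module BothSides {P Q} (tp : TwoPrimes P Q) where
    open TwoPrimes tp
    private
      module 𝒫 = OneSide tp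
      module 𝒬 = OneSide (TwoPrimes-sym tp)

    -- If x in `v` lies outside `P`, a non-zero z killing `v` lies in `P`, hence not in `Q`; as z
    -- kills `v`, all of `v` lies in `Q`.
    side : ∀ v → v ∈ 𝒫.Side ⊎ v ∈ 𝒬.Side
    side v@(_ , (z , z∈ann , z≉0) , _) with lem {P = set v ⊆ mem P}
    ... | yes v⊆P = inj₁ (lift v⊆P)
    ... | no  v⊈P =
      let x , x∈v , x∉P = ⊈⇒∃ v⊈P
          z∈P = 𝒬.cancelQ (trans (*-comm x z) (z∈ann x∈v)) x∉P
      in inj₂ (lift λ y∈v → 𝒫.cancelQ (z∈ann y∈v) (𝒫.∈P⇒∉Q z∈P z≉0))

    isCompleteBipartition : IsCompleteBipartition (EG R) 𝒫.Side 𝒬.Side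
    isCompleteBipartition = record
      { isBipartition = record
          { X-resp   = λ {u} {v} → 𝒫.Side-resp {u} {v}
          ; Y-resp   = λ {u} {v} → 𝒬.Side-resp {u} {v}
          ; cover    = side
          ; disjoint = λ {v} (lift v⊆P) (lift v⊆Q) →
              let x , x∈v , x≉0 = proj₂ (proj₂ v) in x≉0 (P∩Q≈0 (v⊆P x∈v) (v⊆Q x∈v))
          ; X-indep  = λ {u} {v} → 𝒫.Side-indep {u} {v}
          ; Y-indep  = λ {u} {v} → 𝒬.Side-indep {u} {v}
          }
      ; X-nonempty = 𝒫.PV , lift (λ {_} x∈ → x∈)
      ; Y-nonempty = 𝒬.PV , lift (λ {_} x∈ → x∈)
      ; complete   = λ {u} {v} (lift u⊆P) (lift v⊆Q) →
          reduced-orthogonal⇒adjacent 𝒫.reduced {u} {v}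
            λ x∈u y∈v → 𝒫.products-vanish (u⊆P x∈u) (v⊆Q y∈v)
      }

    TwoPrimes⇒K : K₁₁⊎K₁∞⊎K∞∞
    TwoPrimes⇒K with 𝒫.one-or-infinite | 𝒬.one-or-infinite
    ... | inj₁ |P|≡1 | inj₁ |Q|≡1 = inj₁ (_ , _ , isCompleteBipartition , |P|≡1 , |Q|≡1)
    ... | inj₁ |P|≡1 | inj₂ |Q|≡∞ = inj₂ (inj₁ (_ , _ , isCompleteBipartition , |P|≡1 , |Q|≡∞))
    ... | inj₂ |P|≡∞ | inj₁ |Q|≡1 = inj₂ (inj₁ (IsK-sym (EG R) (_ , _ , isCompleteBipartition , |P|≡∞ , |Q|≡1)))
    ... | inj₂ |P|≡∞ | inj₂ |Q|≡∞ = inj₂ (inj₂ (_ , _ , isCompleteBipartition , |P|≡∞ , |Q|≡∞))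

    exactlyTwoMinimalPrimes : |Min|≡2 R
    exactlyTwoMinimalPrimes = P , Q , 𝒫.minimal , 𝒬.minimal ,
      (λ (P⊆Q , _) → let p , p∈P , p≉0 = P≠0 in 𝒫.∈P⇒∉Q p∈P p≉0 (P⊆Q p∈P)) , classify
      where
      -- Since PQ = 0, a prime contains `P` or `Q`; minimality of `S` turns the inclusion into
      -- equality.
      classify : ∀ S → MinimalPrime R S → mem S ≐ mem P ⊎ mem S ≐ mem Q
      classify S (S-prime , S-minimal) with lem {P = mem P ⊆ mem S}
      ... | yes P⊆S = inj₁ (S-minimal P P-prime P⊆S , P⊆S)
      ... | no  P⊈S = inj₂ (S-minimal Q Q-prime Q⊆S , Q⊆S)
        where
        Q⊆S : mem Q ⊆ mem S
        Q⊆S q∈Q =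
          let p , p∈P , p∉S = ⊈⇒∃ P⊈S
          in fromInj₂ (⊥-elim ∘ p∉S) (proj₂ S-prime (On.resp S (sym (𝒫.products-vanish p∈P q∈Q)) (On.0-mem S)))

  -- Splitting a ring into a field and a domain.

  -- R / Ann e, with the equality of the quotient kept at level ℓ.
  quotientByAnn : Carrier → CommutativeRing c ℓ
  quotientByAnn e = record
    { Carrier = Carrier
    ; _≈_     = λ x y → e * x ≈ e * y
    ; _+_     = _+_
    ; _*_     = _*_
    ; -_      = -_
    ; 0#      = 0#
    ; 1#      = 1#
    ; isCommutativeRing = record
        { isRing = record
            { +-isAbelianGroup = record
                { isGroup = record
                    { isMonoid = record
                        { isSemigroup = record
                            { isMagma = record
                                { isEquivalence = record { refl = refl ; sym = sym ; trans = trans }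
                                ; ∙-cong        = λ {x} {y} {u} {v} ex≈ey eu≈ev →
                                    trans (distribˡ e x u) (trans (+-cong ex≈ey eu≈ev) (sym (distribˡ e y v)))
                                }
                            ; assoc = λ x y z → *-congˡ (+-assoc x y z)
                            }
                        ; identity = (λ x → *-congˡ (+-identityˡ x)) , λ x → *-congˡ (+-identityʳ x)
                        }
                    ; inverse = (λ x → *-congˡ (-‿inverseˡ x)) , λ x → *-congˡ (-‿inverseʳ x)
                    ; ⁻¹-cong = λ {x} {y} ex≈ey →
                        trans (sym (-‿distribʳ-* e x)) (trans (-‿cong ex≈ey) (-‿distribʳ-* e y))
                    }
                ; comm = λ x y → *-congˡ (+-comm x y)
                }
            ; *-cong     = λ {x} {y} {u} {v} ex≈ey eu≈ev → begin
                e * (x * u)    ≈⟨ *-assoc e x u ⟨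
                e * x * u      ≈⟨ *-congʳ ex≈ey ⟩
                e * y * u      ≈⟨ xy∙z≈y∙xz e y u ⟩
                y * (e * u)    ≈⟨ *-congˡ eu≈ev ⟩
                y * (e * v)    ≈⟨ x∙yz≈y∙xz y e v ⟩
                e * (y * v)    ∎
            ; *-assoc    = λ x y z → *-congˡ (*-assoc x y z)
            ; *-identity = (λ x → *-congˡ (*-identityˡ x)) , λ x → *-congˡ (*-identityʳ x)
            ; distrib    = (λ x y z → *-congˡ (distribˡ x y z)) , λ x y z → *-congˡ (distribʳ x y z)
            }
        ; *-comm = λ x y → *-congˡ (*-comm x y)
        }
    }

  quotientByAnn-trivial : ∀ {e x} → e * x ≈ e * 0# → e * x ≈ 0#
  quotientByAnn-trivial {e} ex≈e0 = trans ex≈e0 (zeroʳ e)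

  -- The elements `e` and `f` are complementary idempotents. Both quotients keep the carrier of `R`,
  -- so the map is the diagonal, and (a, b) is reached from ea + fb.
  decompose-product : ∀ {e f} → 1# ≈ e + f → f * e ≈ 0# →
                      R ≅ commutativeRing (quotientByAnn e) (quotientByAnn f)
  decompose-product {e} {f} 1≈e+f fe≈0 = (λ x → x , x) , record
    { isRingMonomorphism = record
        { isRingHomomorphism = record
            { isSemiringHomomorphism = record
                { isNearSemiringHomomorphism = record
                    { +-isMonoidHomomorphism = record
                        { isMagmaHomomorphism = record
                            { isRelHomomorphism = record { cong = λ x≈y → *-congˡ x≈y , *-congˡ x≈y }
                            ; homo              = λ _ _ → refl , refl
                            }
                        ; ε-homo = refl , refl
                        }
                    ; *-homo = λ _ _ → refl , refl
                    }
                ; 1#-homo = refl , refl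
                }
            ; -‿homo = λ _ → refl , refl
            }
        ; injective = λ {x} {y} (ex≈ey , fx≈fy) →
            trans (decompose 1≈e+f x) (trans (+-cong ex≈ey fx≈fy) (sym (decompose 1≈e+f y)))
        }
    ; surjective = λ (a , b) → e * a + f * b , λ z≈ →
        trans (*-congˡ z≈) (onto 1≈e+f fe≈0 a b) ,
        trans (*-congˡ (trans z≈ (+-comm (e * a) (f * b))))
              (onto (trans 1≈e+f (+-comm e f)) (trans (*-comm e f) fe≈0) b a)
    }
    where
    onto : ∀ {e f} → 1# ≈ e + f → f * e ≈ 0# → ∀ a b → e * (e * a + f * b) ≈ e * a
    onto {e} {f} 1≈e+f fe≈0 a b = begin
      e * (e * a + f * b)          ≈⟨ distribˡ e (e * a) (f * b) ⟩
      e * (e * a) + e * (f * b)    ≈⟨ +-cong (sym (*-assoc e e a)) (sym (*-assoc e f b)) ⟩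
      e * e * a + e * f * b        ≈⟨ +-cong (*-congʳ (sym (decompose-killed 1≈e+f fe≈0)))
                                             (*-zeroˡ b (trans (*-comm e f) fe≈0)) ⟩
      e * a + 0#                   ≈⟨ +-identityʳ (e * a) ⟩
      e * a                        ∎

  -- Simplicity of `e` inverts every x with ex ≠ 0. On the other side `f` lies in `Q` but not in
  -- `P`, so Ann f is the prime `P` and its quotient is a domain.
  idempotents⇒FieldAndDomain : ∀ {P Q} → TwoPrimes P Q → ∀ {e f} → 1# ≈ e + f → f * e ≈ 0# →
    ¬ (e ≈ 0#) → ¬ (f ≈ 0#) → e ∈ mem P → Simple e → ProductOfFieldAndDomain R
  idempotents⇒FieldAndDomain {P} {Q} tp {e} {f} 1≈e+f fe≈0 e≉0 f≉0 e∈P simple =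
    quotientByAnn e , quotientByAnn f ,
    ((λ e1≈e0 → e≉0 (trans (sym (*-identityʳ e)) (quotientByAnn-trivial e1≈e0))) , inverse) ,
    ((λ f1≈f0 → f≉0 (trans (sym (*-identityʳ f)) (quotientByAnn-trivial f1≈f0))) , λ x y fxy≈f0 →
      Sum.map (vanish x) (vanish y) (proj₂ P-prime (P.cancelQ (quotientByAnn-trivial fxy≈f0) f∉P))) ,
    decompose-product 1≈e+f fe≈0
    where
    open TwoPrimes tp
    open OneSide tp
    module P = OneSide (TwoPrimes-sym tp)
    f∈Q : f ∈ mem Q
    f∈Q = cancelQ (trans (*-comm e f) fe≈0) (∈P⇒∉Q e∈P e≉0)
    f∉P : ¬ (f ∈ mem P)
    f∉P = ∈Q⇒∉P f∈Q f≉0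
    inverse : ∀ x → ¬ (e * x ≈ e * 0#) → ∃ λ y → e * (x * y) ≈ e * 1#
    inverse x ex≉e0 =
      let t , e≈tex = simple (x , *-comm e x) (λ ex≈0 → ex≉e0 (trans ex≈0 (sym (zeroʳ e))))
      in t , trans (x∙yz≈z∙xy e x t) (trans (sym e≈tex) (sym (*-identityʳ e)))
    vanish : ∀ x → x ∈ mem P → f * x ≈ f * 0#
    vanish x x∈P = trans (*-comm f x) (trans (products-vanish x∈P f∈Q) (sym (zeroʳ f)))

  -- In a reduced ring s² ≠ 0, so minimality gives s = rs². Then e = rs fixes s, and its complement
  -- f kills s and hence e. From fe = 0, one of f and e lies in `P`; if it is f, then e lies in `Q`
  -- and the primes are swapped.
  minimalIdeal⇒FieldAndDomain : ∀ {P Q} → TwoPrimes P Q → ∀ I → Minimal R I → ProductOfFieldAndDomain R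
  minimalIdeal⇒FieldAndDomain {P} {Q} tp I ((s , s∈I , s≉0) , least) =
    let r , s≈rs² = least ⟪ s * s ⟫ (s * s , self∈ (s * s) , s²≉0) (⟪⟫⊆ I (On.*-closed I s s∈I)) s∈I
        s≈rss = trans s≈rs² (sym (*-assoc r s s))
        f , 1≈e+f , fs≈0 = complement s≈rss
        fe≈0 = ⟪⟫-killed fs≈0 (r , refl)
        e∈I = On.*-closed I r s∈I
        e≉0 = λ e≈0 → s≉0 (trans s≈rss (*-zeroˡ s e≈0))
        f≉0 = λ f≈0 → 1∉I (On.resp I (sym (trans 1≈e+f (trans (+-congˡ f≈0) (+-identityʳ _)))) e∈I)
        simple = λ {z} z∈E z≉0 → least ⟪ z ⟫ (z , self∈ z , z≉0) (⟪⟫⊆ I (⟪⟫⊆ I e∈I z∈E)) e∈I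
    in [ (λ f∈P → idempotents⇒FieldAndDomain (TwoPrimes-sym tp) 1≈e+f fe≈0 e≉0 f≉0
                    (cancelQ fe≈0 (∈P⇒∉Q f∈P f≉0)) simple)
       , (λ e∈P → idempotents⇒FieldAndDomain tp 1≈e+f fe≈0 e≉0 f≉0 e∈P simple)
       ] (proj₂ P-prime (On.resp P (sym fe≈0) (On.0-mem P)))
    where
    open TwoPrimes tp
    open OneSide tp
    s²≉0 : ¬ (s * s ≈ 0#)
    s²≉0 s²≈0 = s≉0 (reduced⇒square reduced s²≈0)
    -- Were `I` the whole ring, its minimality would put 1 into the non-zero ideal `P`.
    1∉I : ¬ (1# ∈ mem I)
    1∉I 1∈I = 1∉proper P (proj₁ P-prime) (least P P≠0 (λ {x} _ → 1∈⇒universal I 1∈I x) 1∈I)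

  TwoPrimes⇒classification : ∀ {P Q} → TwoPrimes P Q → Classification R
  TwoPrimes⇒classification tp with lem {P = ∃ (Minimal R)}
  ... | yes (I , minimal) = inj₂ (inj₁ (minimalIdeal⇒FieldAndDomain tp I minimal))
  ... | no  none          = inj₂ (inj₂ (inj₁
          (OneSide.reduced tp , BothSides.exactlyTwoMinimalPrimes tp ,
           ⟨⟩-least zero-isIdeal λ (I , minimal , _) → ⊥-elim (none (I , minimal)))))

  -- From the classification back to the graph

  vertex-nonTrivial : ∀ v → NonTrivial R (set v)
  vertex-nonTrivial v = proj₂ (proj₂ v) , λ all → vertex-proper v (all 1#)

  -- The two given vertices must be Nil and Nil² in some order, so both parts are inhabited. A
  -- square-zero element generates a dominating vertex, which is one of the two and so supplies the
  -- edge.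
  ExactlyNilAndNilSquared⇒K₁₁ : ∀ {u v} → ¬ (u ≣ v) → ExactlyNilAndNilSquared R → IsK (EG R) (fin 1) (fin 1)
  ExactlyNilAndNilSquared⇒K₁₁ {u} {v} u≠v (((_ , (n , xⁿ≈0) , x≉0) , _) , _ , Nil≠Nil² , classify) =
    let y , y≉0 , y²≈0 = square-zero x≉0 n xⁿ≈0
        Y = principalVertex y≉0 y≉0 y²≈0
    in X₁ , X₂ , complete Y (squareZero⇒dominating Y (orthogonal-⟪⟫ y²≈0)) (kind Y) (inhabited (kind u) (kind v)) ,
       single X₁ (λ (lift w≐) (lift w′≐) → ≐-trans w≐ (≐-sym w′≐)) (proj₁ (inhabited (kind u) (kind v))) ,
       single X₂ (λ (lift w≐) (lift w′≐) → ≐-trans w≐ (≐-sym w′≐)) (proj₂ (inhabited (kind u) (kind v)))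
    where
    X₁ X₂ : Pred V (Level.suc (c ⊔ ℓ))
    X₁ w = Lift _ (set w ≐ Nil R)
    X₂ w = Lift _ (set w ≐ _·_ R (Nil R) (Nil R))
    kind : ∀ w → w ∈ X₁ ⊎ w ∈ X₂
    kind w = Sum.map lift lift (classify (proj₁ w) (vertex-nonTrivial w))
    single : ∀ (X : Pred V (Level.suc (c ⊔ ℓ))) → (∀ {w w′} → w ∈ X → w′ ∈ X → w ≣ w′) → ∃ X → HasSize (EG R) X 1
    single X unique (w , w∈X) = hasSize-1 (EG R) {v = w} w∈X λ {w′} w′∈X → unique {w′} {w} w′∈X w∈X
    inhabited : u ∈ X₁ ⊎ u ∈ X₂ → v ∈ X₁ ⊎ v ∈ X₂ → ∃ X₁ × ∃ X₂
    inhabited (inj₁ (lift u≐)) (inj₁ (lift v≐)) = ⊥-elim (u≠v (≐-trans u≐ (≐-sym v≐)))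
    inhabited (inj₁ u∈X₁)      (inj₂ v∈X₂)      = (u , u∈X₁) , v , v∈X₂
    inhabited (inj₂ u∈X₂)      (inj₁ v∈X₁)      = (v , v∈X₁) , u , u∈X₂
    inhabited (inj₂ (lift u≐)) (inj₂ (lift v≐)) = ⊥-elim (u≠v (≐-trans u≐ (≐-sym v≐)))
    adjacent : ∀ D → Dominating D → D ∈ X₁ ⊎ D ∈ X₂ → ∀ {w w′} → w ∈ X₁ → w′ ∈ X₂ → w ~ w′
    adjacent D D-dom D∈ {w} {w′} (lift w≐) (lift w′≐) = from D∈
      where
      w≠w′ : ¬ (w ≣ w′)
      w≠w′ w≣w′ = Nil≠Nil² (≐-trans (≐-sym w≐) (≐-trans w≣w′ w′≐))
      from : D ∈ X₁ ⊎ D ∈ X₂ → w ~ w′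
      from (inj₁ (lift D≐)) = dominating⇒adjacent {w} {w′}
        (dominating-resp {D} {w} (≐-trans D≐ (≐-sym w≐)) D-dom) w≠w′
      from (inj₂ (lift D≐)) = ~-sym {w′} {w} (dominating⇒adjacent {w′} {w}
        (dominating-resp {D} {w′} (≐-trans D≐ (≐-sym w′≐)) D-dom) (w≠w′ ∘ ≐-sym))
    complete : ∀ D → Dominating D → D ∈ X₁ ⊎ D ∈ X₂ → ∃ X₁ × ∃ X₂ → IsCompleteBipartition (EG R) X₁ X₂
    complete D D-dom D∈ (X₁≠∅ , X₂≠∅) = record
      { isBipartition = record
          { X-resp   = λ w≣w′ (lift w≐) → lift (≐-trans (≐-sym w≣w′) w≐)
          ; Y-resp   = λ w≣w′ (lift w≐) → lift (≐-trans (≐-sym w≣w′) w≐)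
          ; cover    = kind
          ; disjoint = λ (lift w≐) (lift w≐′) → Nil≠Nil² (≐-trans (≐-sym w≐) w≐′)
          ; X-indep  = λ (lift w≐) (lift w′≐) (w≠w′ , _) → w≠w′ (≐-trans w≐ (≐-sym w′≐))
          ; Y-indep  = λ (lift w≐) (lift w′≐) (w≠w′ , _) → w≠w′ (≐-trans w≐ (≐-sym w′≐))
          }
      ; X-nonempty = X₁≠∅
      ; Y-nonempty = X₂≠∅
      ; complete   = λ {w} {w′} → adjacent D D-dom D∈ {w} {w′}
      }

  -- The ideal `L` witnesses that `I` is not essential. As LI = 0, the non-zero ideals inside `L`
  -- are leaves, each with annihilator `I`.
  module Star (I : Ideal R) (I-minimal : Minimal R I) (I²≈0 : IsZero R (mem (I ⊙ I)))
              (ann≐I : ∀ (J : Ideal R) → NonZero R (mem J) → Annihilating R (mem J) → ¬ (mem J ≐ mem I) →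
                       Ann R (mem J) ≐ mem I)
              (not-essential : ¬ Essential R (mem I))
              (L : Ideal R) (L≠0 : NonZero R (mem L)) (L∩I≈0 : ∀ {x} → x ∈ mem L → x ∈ mem I → x ≈ 0#) where

    I≠0 : NonZero R (mem I)
    I≠0 = proj₁ I-minimal

    I-orthogonal : Orthogonal I I
    I-orthogonal x∈I y∈I = I²≈0 (*∈⊙ I I x∈I y∈I)

    Centre : V
    Centre = I , (let x , x∈I , x≉0 = I≠0 in x , (λ y∈I → I-orthogonal x∈I y∈I) , x≉0) , I≠0

    Centre-dominating : Dominating Centre
    Centre-dominating = squareZero⇒dominating Centre I-orthogonal

    leaf-ann : ∀ v → ¬ (v ≣ Centre) → Ann R (set v) ≐ mem I
    leaf-ann (J , J-ann , J≠0) = ann≐I J J≠0 J-ann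

    ⊆I⇒≣ : ∀ v → set v ⊆ mem I → v ≣ Centre
    ⊆I⇒≣ v v⊆I = v⊆I , proj₂ I-minimal (proj₁ v) (proj₂ (proj₂ v)) v⊆I

    inL : ∀ J → NonZero R (mem J) → mem J ⊆ mem L → V
    inL J J≠0 J⊆L =
      let i , i∈I , i≉0 = I≠0
      in J , (i , (λ {x} x∈J → L∩I≈0 (On.*-closed L i (J⊆L x∈J)) (*-closedʳ I x i∈I)) , i≉0) , J≠0

    inL≠Centre : ∀ J J≠0 (J⊆L : mem J ⊆ mem L) → ¬ (inL J J≠0 J⊆L ≣ Centre)
    inL≠Centre J (x , x∈J , x≉0) J⊆L (J⊆I , _) = x≉0 (L∩I≈0 (J⊆L x∈J) (J⊆I x∈J))

    ann-inL : ∀ J → NonZero R (mem J) → mem J ⊆ mem L → ∀ {z} → z ∈ Ann R (mem J) → z ∈ mem I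
    ann-inL J J≠0 J⊆L = proj₁ (leaf-ann (inL J J≠0 J⊆L) (inL≠Centre J J≠0 J⊆L))

    -- Were uv = I, then for k ∈ v and l ∈ L we would have klu ⊆ lI = 0,
    -- so kl ∈ Ann u ∩ L = I ∩ L = 0, whence v ⊆ Ann L = I.
    leaves-independent : ∀ u v → ¬ (u ≣ Centre) → ¬ (v ≣ Centre) → ¬ (u ~ v)
    leaves-independent u v u≠I v≠I (_ , ess) =
      not-essential (essential-mono (proj₁ (leaf-ann UV UV≠I)) ess)
      where
      product : Ideal R
      product = proj₁ u ⊙ proj₁ v
      product≠0 : NonZero R (mem product)
      product≠0 = ¬IsZero⇒NonZero λ uv≈0 → v≠I (⊆I⇒≣ v λ {y} y∈v →
        proj₁ (leaf-ann u u≠I) λ {x} x∈u → trans (*-comm y x) (uv≈0 (*∈⊙ (proj₁ u) (proj₁ v) x∈u y∈v)))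
      UV : V
      UV = product , (let z , z∈ann , z≉0 = proj₁ (proj₂ u)
                      in z , (λ x∈uv → z∈ann (⊙⊆ˡ (proj₁ u) (proj₁ v) x∈uv)) , z≉0) , product≠0
      UV≠I : ¬ (UV ≣ Centre)
      UV≠I (uv⊆I , _) = v≠I (⊆I⇒≣ v λ {k} k∈v → ann-inL L L≠0 (λ x∈L → x∈L) λ {l} l∈L →
        L∩I≈0 (On.*-closed L k l∈L) (proj₁ (leaf-ann u u≠I) λ {j} j∈u → begin
          k * l * j    ≈⟨ xy∙z≈y∙zx k l j ⟩
          l * (j * k)  ≈⟨ L∩I≈0 (*-closedʳ L (j * k) l∈L)
                            (On.*-closed I l (uv⊆I (*∈⊙ (proj₁ u) (proj₁ v) j∈u k∈v))) ⟩
          0#           ∎))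

    killer : ∀ {a m} → a ∈ mem L → ¬ (a ≈ 0#) → m * a ≈ 0# → m ∈ mem I
    killer {a} a∈L a≉0 ma≈0 =
      ann-inL ⟪ a ⟫ (a , self∈ a , a≉0) (⟪⟫⊆ L a∈L) λ x∈A → ⟪⟫-killed ma≈0 x∈A

    -- If one more factor `a` gives zero, the product lies in Ann a, hence in `I`; it lies in `L`
    -- too, so it was already zero. For m = 1 this shows that `a` is not nilpotent.
    cancel-power : ∀ {a m} → a ∈ mem L → ¬ (a ≈ 0#) → ∀ k → m * a ^ suc k ≈ 0# → m * a ≈ 0#
    cancel-power {a} {m} a∈L a≉0 zero    ma≈0  = trans (*-congˡ (sym (*-identityʳ a))) ma≈0
    cancel-power {a} {m} a∈L a≉0 (suc k) maᵏ≈0 = cancel-power a∈L a≉0 k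
      (L∩I≈0 (On.*-closed L m (*-closedʳ L (a ^ k) a∈L))
        (killer a∈L a≉0 (trans (xy∙z≈x∙zy m (a ^ suc k) a) maᵏ≈0)))

    Leaf : Pred V (Level.suc (c ⊔ ℓ))
    Leaf v = Lift _ (¬ (v ≣ Centre))

    -- Finitely many leaves would give 1 = ta + m with ma = 0, so m lies in `I`. For i in `I` then
    -- mi = 0, and tai lies in both `L` and `I`; so i = 0, against `I` being non-zero.
    infinitely-many-leaves : PartSize (EG R) Leaf ∞
    infinitely-many-leaves n (v , _ , _ , covers) =
      let t , m , k , 1≈ta+m , maᵏ≈0 = finite⇒power-complement v λ i →
            covers {w i} (lift (inL≠Centre ⟪ a ^ suc i ⟫ (power≠0 i) (power⊆L i)))
          i , i∈I , i≉0 = I≠0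
          m∈I = killer a∈L a≉0 (cancel-power a∈L a≉0 k maᵏ≈0)
      in i≉0 (begin
           i            ≈⟨ decompose-killed 1≈ta+m (I-orthogonal m∈I i∈I) ⟩
           t * a * i    ≈⟨ L∩I≈0 (*-closedʳ L i (On.*-closed L t a∈L)) (On.*-closed I (t * a) i∈I) ⟩
           0#           ∎)
      where
      a : Carrier
      a = proj₁ L≠0
      a∈L : a ∈ mem L
      a∈L = proj₁ (proj₂ L≠0)
      a≉0 : ¬ (a ≈ 0#)
      a≉0 = proj₂ (proj₂ L≠0)
      power≠0 : ∀ i → NonZero R (mem ⟪ a ^ suc i ⟫)
      power≠0 i = a ^ suc i , self∈ (a ^ suc i) , λ aⁱ≈0 → a≉0
        (trans (sym (*-identityˡ a)) (cancel-power a∈L a≉0 i (*-zeroʳ 1# aⁱ≈0)))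
      power⊆L : ∀ i → mem ⟪ a ^ suc i ⟫ ⊆ mem L
      power⊆L i = ⟪⟫⊆ L (*-closedʳ L (a ^ i) a∈L)
      w : ℕ → V
      w i = inL ⟪ a ^ suc i ⟫ (power≠0 i) (power⊆L i)

    isK₁∞ : IsK (EG R) (fin 1) ∞
    isK₁∞ = (λ v → Lift _ (v ≣ Centre)) , Leaf , record
      { isBipartition = record
          { X-resp   = λ u≣v (lift u≣I) → lift (≐-trans (≐-sym u≣v) u≣I)
          ; Y-resp   = λ u≣v (lift u≠I) → lift (λ v≣I → u≠I (≐-trans u≣v v≣I))
          ; cover    = cover
          ; disjoint = λ (lift v≣I) (lift v≠I) → v≠I v≣I
          ; X-indep  = λ (lift u≣I) (lift v≣I) (u≠v , _) → u≠v (≐-trans u≣I (≐-sym v≣I))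
          ; Y-indep  = λ {u} {v} (lift u≠I) (lift v≠I) → leaves-independent u v u≠I v≠I
          }
      ; X-nonempty = Centre , lift ≐-refl
      ; Y-nonempty = inL L L≠0 (λ x∈L → x∈L) , lift (inL≠Centre L L≠0 (λ x∈L → x∈L))
      ; complete   = λ {u} {v} (lift u≣I) (lift v≠I) → dominating⇒adjacent {u} {v}
          (dominating-resp {Centre} {u} (≐-sym u≣I) Centre-dominating)
          (λ u≣v → v≠I (≐-trans (≐-sym u≣v) u≣I))
      } , hasSize-1 (EG R) {v = Centre} (lift ≐-refl) lower , infinitely-many-leaves
      where
      cover : ∀ v → Lift _ (v ≣ Centre) ⊎ v ∈ Leaf
      cover v with lem {P = v ≣ Centre}
      ... | yes v≣I = inj₁ (lift v≣I)
      ... | no  v≠I = inj₂ (lift v≠I)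

  NonEssentialMinimal⇒K₁∞ : NonEssentialMinimalSquareZero R → IsK (EG R) (fin 1) ∞
  NonEssentialMinimal⇒K₁∞ (I , I-minimal , not-ess , I²≈0 , ann≐I) =
    let L , L≠0 , L∩I≈0 = disjoint in Star.isK₁∞ I I-minimal I²≈0 ann≐I not-ess L L≠0 L∩I≈0
    where
    disjoint : ∃ λ L → NonZero R (mem L) × (∀ {x} → x ∈ mem L → x ∈ mem I → x ≈ 0#)
    disjoint = byContradiction λ none → not-ess (proj₁ I-minimal , λ L L≠0 → byContradiction λ L∩I≈0 →
      none (L , L≠0 , λ {x} x∈L x∈I → byContradiction λ x≉0 → L∩I≈0 (x , (x∈I , x∈L) , x≉0)))

  module DomainQuotient (D : CommutativeRing c ℓ) (D-domain : IsDomain D) {φ : Carrier → CommutativeRing.Carrier D}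
    (hom : RingMorphisms.IsRingHomomorphism rawRing (CommutativeRing.rawRing D) φ) where
    private module D = CommutativeRing D
    open RingMorphisms.IsRingHomomorphism hom

    kernel : Ideal R
    kernel = ideal (λ x → Lift c (φ x D.≈ D.0#)) record
      { resp     = λ x≈y (lift φx≈0) → lift (D.trans (⟦⟧-cong (sym x≈y)) φx≈0)
      ; 0-mem    = lift 0#-homo
      ; +-closed = λ {x} {y} (lift φx≈0) (lift φy≈0) →
          lift (D.trans (+-homo x y) (D.trans (D.+-cong φx≈0 φy≈0) (D.+-identityʳ D.0#)))
      ; *-closed = λ r {x} (lift φx≈0) →
          lift (D.trans (*-homo r x) (D.trans (D.*-congˡ φx≈0) (D.zeroʳ (φ r))))
      }

    kernel-prime : Prime R kernel
    kernel-prime =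
      (λ all → proj₁ D-domain (D.trans (D.sym 1#-homo) (lower (all 1#)))) ,
      λ {x} {y} (lift φxy≈0) →
        Sum.map lift lift (proj₂ D-domain (φ x) (φ y) (D.trans (D.sym (*-homo x y)) φxy≈0))

  field⇒domain : ∀ (F : CommutativeRing c ℓ) → IsField F → IsDomain F
  field⇒domain F (1≉0 , inverse) = 1≉0 , λ x y xy≈0 → split x y xy≈0
    where
    module F = CommutativeRing F
    split : ∀ x y → x F.* y F.≈ F.0# → x F.≈ F.0# ⊎ y F.≈ F.0#
    split x y xy≈0 with lem {P = x F.≈ F.0#}
    ... | yes x≈0 = inj₁ x≈0
    ... | no  x≉0 =
      let z , xz≈1 = inverse x x≉0
      in inj₂ (F.trans (F.sym (F.*-identityˡ y)) (F.trans (F.*-congʳ (F.trans (F.sym xz≈1) (F.*-comm x z)))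
           (F.trans (F.*-assoc z x y) (F.trans (F.*-congˡ xy≈0) (F.zeroʳ z)))))

  -- The primes are the kernels of the two projections; preimages of (0, 1) and (1, 0) show them to
  -- be non-zero.
  productOfDomains⇒TwoPrimes : ∀ (D E : CommutativeRing c ℓ) → IsDomain D → IsDomain E →
                               R ≅ commutativeRing D E → ∃₂ TwoPrimes
  productOfDomains⇒TwoPrimes D E D-domain E-domain (φ , iso) = 𝒟.kernel , ℰ.kernel , record
    { P-prime = 𝒟.kernel-prime
    ; Q-prime = ℰ.kernel-prime
    ; P≠0     = let x , φx≈ = surjective (D.0# , E.1#)
                in x , lift (proj₁ (φx≈ refl)) ,
                   λ x≈0 → proj₁ E-domain (E.trans (E.sym (proj₂ (φx≈ refl)))
                                             (E.trans (proj₂ (⟦⟧-cong x≈0)) (proj₂ 0#-homo)))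
    ; Q≠0     = let x , φx≈ = surjective (D.1# , E.0#)
                in x , lift (proj₂ (φx≈ refl)) ,
                   λ x≈0 → proj₁ D-domain (D.trans (D.sym (proj₁ (φx≈ refl)))
                                             (D.trans (proj₁ (⟦⟧-cong x≈0)) (proj₁ 0#-homo)))
    ; P∩Q≈0   = λ (lift x≈0) (lift x≈0′) → injective
        (D.trans x≈0 (D.sym (proj₁ 0#-homo)) , E.trans x≈0′ (E.sym (proj₂ 0#-homo)))
    }
    where
    module D = CommutativeRing D
    module E = CommutativeRing E
    open RingMorphisms.IsRingIsomorphism iso
    fst-hom : RingMorphisms.IsRingHomomorphism rawRing D.rawRing (proj₁ ∘ φ)
    fst-hom = record
      { isSemiringHomomorphism = record
          { isNearSemiringHomomorphism = record
              { +-isMonoidHomomorphism = record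
                  { isMagmaHomomorphism = record
                      { isRelHomomorphism = record { cong = proj₁ ∘ ⟦⟧-cong }
                      ; homo              = λ x y → proj₁ (+-homo x y)
                      }
                  ; ε-homo = proj₁ 0#-homo
                  }
              ; *-homo = λ x y → proj₁ (*-homo x y)
              }
          ; 1#-homo = proj₁ 1#-homo
          }
      ; -‿homo = λ x → proj₁ (-‿homo x)
      }
    snd-hom : RingMorphisms.IsRingHomomorphism rawRing E.rawRing (proj₂ ∘ φ)
    snd-hom = record
      { isSemiringHomomorphism = record
          { isNearSemiringHomomorphism = record
              { +-isMonoidHomomorphism = record
                  { isMagmaHomomorphism = record
                      { isRelHomomorphism = record { cong = proj₂ ∘ ⟦⟧-cong }
                      ; homo              = λ x y → proj₂ (+-homo x y)
                      }
                  ; ε-homo = proj₂ 0#-homo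
                  }
              ; *-homo = λ x y → proj₂ (*-homo x y)
              }
          ; 1#-homo = proj₂ 1#-homo
          }
      ; -‿homo = λ x → proj₂ (-‿homo x)
      }
    module 𝒟 = DomainQuotient D D-domain {proj₁ ∘ φ} fst-hom
    module ℰ = DomainQuotient E E-domain {proj₂ ∘ φ} snd-hom

  -- Existence of minimal primes

  -- In a reduced ring, the complement of a maximal such set is a minimal prime that avoids `x`.
  record MultiplicativeAt (x : Carrier) (S : Pred Carrier (c ⊔ ℓ)) : Set (c ⊔ ℓ) where
    field
      ≈-resp   : ∀ {y z} → y ≈ z → y ∈ S → z ∈ S
      x-mem    : x ∈ S
      1-mem    : 1# ∈ S
      *-closed : ∀ {y z} → y ∈ S → z ∈ S → y * z ∈ S
      0-∉      : ¬ (0# ∈ S)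

    ^-mem : ∀ n → x ^ n ∈ S
    ^-mem zero    = 1-mem
    ^-mem (suc n) = *-closed x-mem (^-mem n)

  MultiplicativeSet : Carrier → Set (Level.suc (c ⊔ ℓ))
  MultiplicativeSet x = Σ (Pred Carrier (c ⊔ ℓ)) (MultiplicativeAt x)

  multiplicativePoset : Carrier → Poset _ _ _
  multiplicativePoset x = record
    { Carrier        = MultiplicativeSet x
    ; _≈_            = λ (S , _) (T , _) → S ≐ T
    ; _≤_            = λ (S , _) (T , _) → S ⊆ T
    ; isPartialOrder = record
        { isPreorder = record
            { isEquivalence = record { refl = ≐-refl ; sym = ≐-sym ; trans = ≐-trans }
            ; reflexive     = proj₁
            ; trans         = λ S⊆T T⊆U y∈S → T⊆U (S⊆T y∈S)
            }
        ; antisym = _,_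
        }
    }

  -- Excluded middle brings a proposition of any level down to the level of ideals.
  Resize : ∀ {a} → Set a → Set (c ⊔ ℓ)
  Resize P = Lift _ (True (lem {P = P}))

  resize : ∀ {a} {P : Set a} → P → Resize P
  resize p = lift (fromWitness p)

  unresize : ∀ {a} {P : Set a} → Resize P → P
  unresize (lift t) = toWitness t

  -- The powers of x are included so that the empty chain is bounded too.
  chain-bound : Reduced R → ∀ {x} → ¬ (x ≈ 0#) → (C : Pred (MultiplicativeSet x) Level.zero) →
    (∀ {S T} → S ∈ C → T ∈ C → proj₁ S ⊆ proj₁ T ⊎ proj₁ T ⊆ proj₁ S) →
    ∃ λ (U : MultiplicativeSet x) → ∀ {S} → S ∈ C → proj₁ S ⊆ proj₁ U
  chain-bound reduced {x} x≉0 C chain =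
    ((λ z → Resize (Union z)) , record
      { ≈-resp   = λ y≈z y∈U → resize (Union-resp y≈z (unresize y∈U))
      ; x-mem    = resize (inj₁ (1 , sym (*-identityʳ x)))
      ; 1-mem    = resize (inj₁ (0 , refl))
      ; *-closed = λ y∈U z∈U → resize (Union-* (unresize y∈U) (unresize z∈U))
      ; 0-∉      = λ 0∈U → 0∉Union (unresize 0∈U)
      }) , λ {S} S∈C z∈S → resize (inj₂ (S , S∈C , z∈S))
    where
    module Mult {S : MultiplicativeSet x} = MultiplicativeAt (proj₂ S)
    Union : Pred Carrier _
    Union z = (∃ λ n → z ≈ x ^ n) ⊎ (∃ λ S → S ∈ C × z ∈ proj₁ S)
    Union-resp : ∀ {y z} → y ≈ z → Union y → Union z
    Union-resp y≈z (inj₁ (n , y≈xⁿ))      = inj₁ (n , trans (sym y≈z) y≈xⁿ)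
    Union-resp y≈z (inj₂ (S , S∈C , y∈S)) = inj₂ (S , S∈C , Mult.≈-resp {S} y≈z y∈S)
    power∈ : ∀ S {z} → ∃ (λ n → z ≈ x ^ n) → z ∈ proj₁ S
    power∈ S (n , z≈xⁿ) = Mult.≈-resp {S} (sym z≈xⁿ) (Mult.^-mem {S} n)
    Union-* : ∀ {y z} → Union y → Union z → Union (y * z)
    Union-* (inj₁ (m , y≈xᵐ)) (inj₁ (n , z≈xⁿ)) =
      inj₁ (m ℕ.+ n , trans (*-cong y≈xᵐ z≈xⁿ) (sym (^-homo-* x m n)))
    Union-* (inj₁ y∈powers) (inj₂ (S , S∈C , z∈S)) =
      inj₂ (S , S∈C , Mult.*-closed {S} (power∈ S y∈powers) z∈S)
    Union-* (inj₂ (S , S∈C , y∈S)) (inj₁ z∈powers) =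
      inj₂ (S , S∈C , Mult.*-closed {S} y∈S (power∈ S z∈powers))
    Union-* (inj₂ (S , S∈C , y∈S)) (inj₂ (T , T∈C , z∈T)) with chain {S} {T} S∈C T∈C
    ... | inj₁ S⊆T = inj₂ (T , T∈C , Mult.*-closed {T} (S⊆T y∈S) z∈T)
    ... | inj₂ T⊆S = inj₂ (S , S∈C , Mult.*-closed {S} y∈S (T⊆S z∈T))
    0∉Union : ¬ Union 0#
    0∉Union (inj₁ (n , 0≈xⁿ))      = x≉0 (reduced (n , sym 0≈xⁿ))
    0∉Union (inj₂ (S , S∈C , 0∈S)) = Mult.0-∉ {S} 0∈S

  module MaximalMultiplicative (reduced : Reduced R) {x} (S : Pred Carrier (c ⊔ ℓ)) (S-mult : MultiplicativeAt x S)
    (maximal : ∀ T → MultiplicativeAt x T → S ⊆ T → T ⊆ S) where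
    module S = MultiplicativeAt S-mult

    -- The kernel of localisation at `S`; maximality makes it the complement of `S`.
    killedBySome : Ideal R
    killedBySome = ideal (λ a → ∃ λ s → s ∈ S × s * a ≈ 0#) record
      { resp     = λ a≈b (s , s∈S , sa≈0) → s , s∈S , trans (*-congˡ (sym a≈b)) sa≈0
      ; 0-mem    = 1# , S.1-mem , zeroʳ 1#
      ; +-closed = λ {a} {b} (s , s∈S , sa≈0) (t , t∈S , tb≈0) → s * t , S.*-closed s∈S t∈S , (begin
          s * t * (a + b)            ≈⟨ distribˡ (s * t) a b ⟩
          s * t * a + s * t * b      ≈⟨ +-cong (trans (xy∙z≈y∙xz s t a) (*-zeroʳ t sa≈0))
                                               (trans (*-assoc s t b) (*-zeroʳ s tb≈0)) ⟩
          0# + 0#                    ≈⟨ +-identityʳ 0# ⟩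
          0#                         ∎)
      ; *-closed = λ r {a} (s , s∈S , sa≈0) → s , s∈S , trans (x∙yz≈y∙xz s r a) (*-zeroʳ r sa≈0)
      }

    -- If no s ∈ S killed a, then adjoining a to S would contradict maximality.
    ∉⇒killed : ∀ {a} → ¬ (a ∈ S) → a ∈ mem killedBySome
    ∉⇒killed {a} a∉S = byContradiction λ not-killed →
      a∉S (maximal S[a] (adjoined not-killed) (λ {s} s∈S → s , 0 , s∈S , sym (*-identityʳ s))
            (1# , 1 , S.1-mem , trans (sym (*-identityʳ a)) (sym (*-identityˡ (a ^ 1)))))
      where
      S[a] : Pred Carrier (c ⊔ ℓ)
      S[a] z = ∃₂ λ s n → s ∈ S × z ≈ s * a ^ n
      -- If s times a positive power of `a` vanishes, then sa is nilpotent, hence zero, and s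
      -- already kills `a`.
      nonzero : ¬ (a ∈ mem killedBySome) → ∀ n {s} → s ∈ S → ¬ (s * a ^ n ≈ 0#)
      nonzero not-killed zero    {s} s∈S s1≈0 = S.0-∉ (S.≈-resp (trans (sym (*-identityʳ s)) s1≈0) s∈S)
      nonzero not-killed (suc n) {s} s∈S saⁿ≈0 = not-killed (s , s∈S , reduced (suc n , (begin
        (s * a) ^ suc n            ≈⟨ ^-distrib-* s a (suc n) ⟩
        s * s ^ n * a ^ suc n      ≈⟨ xy∙z≈y∙xz s (s ^ n) (a ^ suc n) ⟩
        s ^ n * (s * a ^ suc n)    ≈⟨ *-zeroʳ (s ^ n) saⁿ≈0 ⟩
        0#                         ∎)))
      adjoined : ¬ (a ∈ mem killedBySome) → MultiplicativeAt x S[a]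
      adjoined not-killed = record
        { ≈-resp   = λ y≈z (s , n , s∈S , y≈) → s , n , s∈S , trans (sym y≈z) y≈
        ; x-mem    = x , 0 , S.x-mem , sym (*-identityʳ x)
        ; 1-mem    = 1# , 0 , S.1-mem , sym (*-identityʳ 1#)
        ; *-closed = λ {y} {z} (s , m , s∈S , y≈) (t , n , t∈S , z≈) → s * t , m ℕ.+ n , S.*-closed s∈S t∈S , (begin
            y * z                        ≈⟨ *-cong y≈ z≈ ⟩
            s * a ^ m * (t * a ^ n)      ≈⟨ interchange s (a ^ m) t (a ^ n) ⟩
            s * t * (a ^ m * a ^ n)      ≈⟨ *-congˡ (^-homo-* a m n) ⟨
            s * t * a ^ (m ℕ.+ n)        ∎)
        ; 0-∉      = λ (s , n , s∈S , 0≈) → nonzero not-killed n s∈S (sym 0≈)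
        }

    ∈⇒¬killed : ∀ {a} → a ∈ S → ¬ (a ∈ mem killedBySome)
    ∈⇒¬killed a∈S (s , s∈S , sa≈0) = S.0-∉ (S.≈-resp sa≈0 (S.*-closed s∈S a∈S))

    killed-prime : Prime R killedBySome
    killed-prime = (λ all → ∈⇒¬killed S.1-mem (all 1#)) , split
      where
      split : ∀ {a b} → a * b ∈ mem killedBySome → a ∈ mem killedBySome ⊎ b ∈ mem killedBySome
      split {a} {b} ab∈ with lem {P = a ∈ S} | lem {P = b ∈ S}
      ... | no a∉S  | _       = inj₁ (∉⇒killed a∉S)
      ... | yes _   | no b∉S  = inj₂ (∉⇒killed b∉S)
      ... | yes a∈S | yes b∈S = ⊥-elim (∈⇒¬killed (S.*-closed a∈S b∈S) ab∈)

    -- The complement of a smaller prime `Q` is again multiplicative and contains `S`, so by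
    -- maximality it is no larger.
    killed-minimalPrime : MinimalPrime R killedBySome
    killed-minimalPrime = killed-prime , λ Q Q-prime Q⊆N {a} a∈N → byContradiction λ a∉Q →
      ∈⇒¬killed (maximal (λ z → Lift c (Lift ℓ (¬ (z ∈ mem Q)))) (complement-mult Q Q-prime Q⊆N)
        (λ s∈S → lift (lift λ s∈Q → ∈⇒¬killed s∈S (Q⊆N s∈Q))) (lift (lift a∉Q))) a∈N
      where
      complement-mult : ∀ Q → Prime R Q → mem Q ⊆ mem killedBySome →
                        MultiplicativeAt x (λ z → Lift c (Lift ℓ (¬ (z ∈ mem Q))))
      complement-mult Q (proper , split) Q⊆N = record
        { ≈-resp   = λ y≈z (lift (lift y∉Q)) → lift (lift λ z∈Q → y∉Q (On.resp Q (sym y≈z) z∈Q))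
        ; x-mem    = lift (lift λ x∈Q → ∈⇒¬killed S.x-mem (Q⊆N x∈Q))
        ; 1-mem    = lift (lift (1∉proper Q proper))
        ; *-closed = λ (lift (lift y∉Q)) (lift (lift z∉Q)) → lift (lift λ yz∈Q → [ y∉Q , z∉Q ] (split yz∈Q))
        ; 0-∉      = λ (lift (lift 0∉Q)) → 0∉Q (On.0-mem Q)
        }

  minimalPrime-avoiding : Zorn → Reduced R → ∀ {x} → ¬ (x ≈ 0#) → ∃ λ N → MinimalPrime R N × ¬ (x ∈ mem N)
  minimalPrime-avoiding zorn reduced {x} x≉0 =
    let (S , S-mult) , S-maximal = zorn (multiplicativePoset x) (chain-bound reduced x≉0)
        open MaximalMultiplicative reduced S S-mult (λ T T-mult S⊆T → S-maximal {T , T-mult} S⊆T)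
    in killedBySome , killed-minimalPrime , ∈⇒¬killed (MultiplicativeAt.x-mem S-mult)

  -- A non-zero element of both primes would be avoided by some minimal prime, yet there are only
  -- these two. If one were zero, it would lie inside the other and equal it by minimality.
  twoMinimalPrimes⇒TwoPrimes : Zorn → Reduced R → |Min|≡2 R → ∃₂ TwoPrimes
  twoMinimalPrimes⇒TwoPrimes zorn reduced (P , Q , (P-prime , P-minimal) , (Q-prime , Q-minimal) , P≠Q , onlyPQ) =
    P , Q , record
      { P-prime = P-prime
      ; Q-prime = Q-prime
      ; P≠0     = ¬IsZero⇒NonZero λ P≈0 → P≠Q (zero⇒≐ P Q Q-minimal P-prime P≈0)
      ; Q≠0     = ¬IsZero⇒NonZero λ Q≈0 → P≠Q (≐-sym (zero⇒≐ Q P P-minimal Q-prime Q≈0))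
      ; P∩Q≈0   = λ x∈P x∈Q → byContradiction λ x≉0 →
          let N , N-minimal , x∉N = minimalPrime-avoiding zorn reduced x≉0
          in x∉N ([ (λ N≐P → proj₂ N≐P x∈P) , (λ N≐Q → proj₂ N≐Q x∈Q) ] (onlyPQ N N-minimal))
      }
    where
    zero⇒≐ : ∀ I J → (∀ T → Prime R T → mem T ⊆ mem J → mem J ⊆ mem T) → Prime R I →
             IsZero R (mem I) → mem I ≐ mem J
    zero⇒≐ I J J-minimal I-prime I≈0 = I⊆J , J-minimal I I-prime I⊆J
      where
      I⊆J : mem I ⊆ mem J
      I⊆J x∈I = On.resp J (sym (I≈0 x∈I)) (On.0-mem J)

  -- The cycle through triangle-freeness, the classification and the three graphs.

  classification⇒K : Zorn → ∀ {u v} → ¬ (u ≣ v) → Classification R → K₁₁⊎K₁∞⊎K∞∞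
  classification⇒K zorn {u} {v} u≠v = λ where
      (inj₁ (F₁ , F₂ , F₁-field , F₂-field , iso)) →
        fromTwoPrimes (productOfDomains⇒TwoPrimes F₁ F₂ (field⇒domain F₁ F₁-field) (field⇒domain F₂ F₂-field) iso)
      (inj₂ (inj₁ (F , D , F-field , D-domain , iso))) →
        fromTwoPrimes (productOfDomains⇒TwoPrimes F D (field⇒domain F F-field) D-domain iso)
      (inj₂ (inj₂ (inj₁ (reduced , |Min|≡2 , _)))) →
        fromTwoPrimes (twoMinimalPrimes⇒TwoPrimes zorn reduced |Min|≡2)
      (inj₂ (inj₂ (inj₂ (inj₁ nil)))) → inj₁ (ExactlyNilAndNilSquared⇒K₁₁ {u} {v} u≠v nil)
      (inj₂ (inj₂ (inj₂ (inj₂ star)))) → inj₂ (inj₁ (NonEssentialMinimal⇒K₁∞ star))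
    where
    fromTwoPrimes : ∃₂ TwoPrimes → K₁₁⊎K₁∞⊎K∞∞
    fromTwoPrimes (_ , _ , tp) = BothSides.TwoPrimes⇒K tp

  triangleFree⇒classification : ∀ {u v} → ¬ (u ≣ v) → TriangleFree (EG R) → Classification R
  triangleFree⇒classification {u} {v} u≠v tf with lem {P = Reduced R}
  ... | yes reduced = let _ , _ , tp = reduced⇒TwoPrimes reduced tf u in TwoPrimes⇒classification tp
  ... | no  ¬reduced = inj₂ (inj₂ (inj₂ (nonReduced⇒ tf {u} {v} u≠v ¬reduced)))

  K⇒completeBipartite : K₁₁⊎K₁∞⊎K∞∞ → CompleteBipartite (EG R)
  K⇒completeBipartite = [ IsK⇒ , [ IsK⇒ , IsK⇒ ] ]
    where
    IsK⇒ : ∀ {m n} → IsK (EG R) m n → CompleteBipartite (EG R)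
    IsK⇒ = IsK⇒completeBipartite (EG R)

theorem2p3 : LEM → Zorn →
    ∀ {c ℓ} (R : CommutativeRing c ℓ) → AtLeastTwoNonTrivialAnnihilating R →
    (CliqueNumber (EG R) 2 ⇔ ChromaticNumber (EG R) 2)
    × (ChromaticNumber (EG R) 2 ⇔ Bipartite (EG R))
    × (Bipartite (EG R) ⇔ CompleteBipartite (EG R))
    × (CompleteBipartite (EG R) ⇔
    (IsK (EG R) (fin 1) (fin 1) ⊎ IsK (EG R) (fin 1) ∞ ⊎ IsK (EG R) ∞ ∞))
    × ((IsK (EG R) (fin 1) (fin 1) ⊎ IsK (EG R) (fin 1) ∞ ⊎ IsK (EG R) ∞ ∞) ⇔
    Classification R)
theorem2p3 lem zorn R (I , J , ((I≠0 , _) , I-ann) , ((J≠0 , _) , J-ann) , I≠J) =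
  -- The two given ideals supply an edge, hence the lower bounds for clique and chromatic number.
  -- The rest goes through triangle-freeness and the classification.
  mk⇔ (λ ω≡2 → edge∧bipartite⇒χ≡2 (EG R) edge (K⇒bipartite (tf⇒K (ω⇒tf ω≡2))))
      (λ χ≡2 → edge∧triangleFree⇒ω≡2 (EG R) edge (χ⇒tf χ≡2)) ,
  mk⇔ (λ χ≡2 → K⇒bipartite (tf⇒K (χ⇒tf χ≡2)))
      (edge∧bipartite⇒χ≡2 (EG R) edge) ,
  mk⇔ (λ bip → K⇒completeBipartite (tf⇒K (bipartite⇒triangleFree (EG R) bip)))
      (completeBipartite⇒bipartite (EG R)) ,
  mk⇔ (λ cb → tf⇒K (bipartite⇒triangleFree (EG R) (completeBipartite⇒bipartite (EG R) cb)))
      K⇒completeBipartite ,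
  mk⇔ (λ k → triangleFree⇒classification {u} {v} I≠J (bipartite⇒triangleFree (EG R) (K⇒bipartite k)))
      (classification⇒K zorn {u} {v} I≠J)
  where
  open EssentialGraph lem R
  u v : SimpleGraph.Vertex (EG R)
  u = I , I-ann , I≠0
  v = J , J-ann , J≠0
  edge : Edge (EG R)
  edge = edge-exists {u} {v} I≠J
  K⇒bipartite : K₁₁⊎K₁∞⊎K∞∞ → Bipartite (EG R)
  K⇒bipartite k = completeBipartite⇒bipartite (EG R) (K⇒completeBipartite k)
  tf⇒K : TriangleFree (EG R) → K₁₁⊎K₁∞⊎K∞∞
  tf⇒K tf = classification⇒K zorn {u} {v} I≠J (triangleFree⇒classification {u} {v} I≠J tf)
  ω⇒tf : CliqueNumber (EG R) 2 → TriangleFree (EG R)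
  ω⇒tf (_ , small) = noLargeClique⇒triangleFree (EG R) small
  χ⇒tf : ChromaticNumber (EG R) 2 → TriangleFree (EG R)
  χ⇒tf (colouring , _) = noLargeClique⇒triangleFree (EG R) (colouring⇒noLargeClique (EG R) colouring)
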